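{- Let $n$ be a positive integer and let $D=(D_1,D_2,D_3)$ be a tripartite hypergraph degree sequence on $n+n+n$ vertices, i.e. $D_k=(d_{k,1},\dots,d_{k,n})$ is a sequence of $n$ non-negative integers for each $k=1,2,3$. Suppose that $\sum_{i=1}^n d_{1,i}=\sum_{i=1}^n d_{2,i}=\sum_{i=1}^n d_{3,i}$ and that $$\frac{2n^2}{7}\le d_{k,i}\le \frac{5n^2}{7}$$ for all $k\in\{1,2,3\}$ and $i\in\{1,\dots,n\}$. Then $D$ is graphic, i.e. $D$ has a tripartite hypergraph realization.
   Context: A tripartite hypergraph (short for partite $3$-uniform hypergraph) $H=(V_1,V_2,V_3,E)$ has vertex set the disjoint union of finite sets $V_1,V_2,V_3$ (the vertex classes), and $E$ is a set of hyperedges, each hyperedge $e$ being a $3$-element subset of $V_1\cup V_2\cup V_3$ with $|e\cap V_k|=1$ for $k=1,2,3$ (no hyperedge is repeated). The degree of a vertex is the number of hyperedges containing it. A tripartite hypergraph degree sequence $D=(D_1,D_2,D_3)$, with $D_k=(d_{k,1},\dots,d_{k,n_k})$ a sequence of non-negative integers, is graphic if there is a tripartite hypergraph with $|V_k|=n_k$, called a realization of $D$, such that the degrees of the vertices of $V_k$ are $d_{k,1},\dots,d_{k,n_k}$ for each $k=1,2,3$. -}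

module Defs where

open import Data.Fin.Base using (Fin)
open import Data.Fin.Patterns using (0F; 1F; 2F)
open import Data.Fin.Subset using (Subset; ∣_∣)
open import Data.Fin.Subset.Properties using (_∈?_)
open import Data.List.Base using (List; length; filter)
open import Data.List.Relation.Unary.All using (All)
open import Data.List.Relation.Unary.Unique.Propositional using (Unique)
open import Data.Nat.Base using (ℕ)
open import Data.Product.Base using (∃-syntax)
open import Data.Vec.Functional using (Vector)
open import Relation.Binary.PropositionalEquality.Core using (_≡_)

-- Throughout, n gives the sizes of the three vertex classes, and class k is
-- Fin (n k).

-- A set of vertices: as the classes are disjoint, a subset of their union
-- is given by its intersections with them.  A record rather than a function
-- on Fin 3, so that propositional equality is equality of sets.
record VertexSet (n : Fin 3 → ℕ) : Set where
  constructor ⟨_,_,_⟩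
  field
    part₁ : Subset (n 0F)
    part₂ : Subset (n 1F)
    part₃ : Subset (n 2F)

_∩class_ : ∀ {n} → VertexSet n → (k : Fin 3) → Subset (n k)
e ∩class 0F = VertexSet.part₁ e
e ∩class 1F = VertexSet.part₂ e
e ∩class 2F = VertexSet.part₃ e

-- One vertex from each class; in particular e has exactly three elements.
IsHyperedge : ∀ {n} → VertexSet n → Set
IsHyperedge e = ∀ k → ∣ e ∩class k ∣ ≡ 1

-- The finite set E is a list without repetitions.
record TripartiteHypergraph (n : Fin 3 → ℕ) : Set where
  field
    E          : List (VertexSet n)
    hyperedges : All IsHyperedge E
    distinct   : Unique E

degree : ∀ {n} → TripartiteHypergraph n → (k : Fin 3) → Fin (n k) → ℕ
degree H k v = length (filter (λ e → v ∈? (e ∩class k)) (TripartiteHypergraph.E H))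

DegreeSequence : (Fin 3 → ℕ) → Set
DegreeSequence n = (k : Fin 3) → Vector ℕ (n k)

Graphic : (n : Fin 3 → ℕ) → DegreeSequence n → Set
Graphic n D = ∃[ H ] (∀ k i → degree {n} H k i ≡ D k i)

{-# OPTIONS --safe #-}
module Submission where

-- A flip moves one hyperedge from a vertex i to a vertex j of the same class with deg j < deg i
-- and keeps all other degrees, so each class can be rebalanced on its own: it is enough to find a
-- hypergraph with S hyperedges (S the common degree sum) whose degrees are more spread out than D.
-- Put m = ⌈2n²/7⌉ and sort each D k increasingly.  If for some b, in every class, the vertices
-- below b have total degree at most b m and those above b have total degree at least
-- (n − 1 − b)(n² − m), then flips turn the degrees into D.
--
-- Call the vertices ≥ l high.  Take all triples with two high vertices, or with one high vertex
-- whose other two vertices form a pair outside a fixed set of m pairs.  Then high vertices have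
-- degree at least n² − m, and the inequality
--     7 a l (a + 2l) ≤ 2 (a + l)² (2a + l),   a = n − l,
-- says that the low ones have average degree at most m.  These hypergraphs grow as l decreases
-- from n to n/2, and every hypergraph between two consecutive ones meets the condition above, so
-- every S ≤ n³/2 is attained; complementation gives the remaining S.

open import Defs
open import Data.Bool.Base using (Bool; true; false; not; _∧_; _∨_; T; if_then_else_)
open import Data.Bool.Properties using (∨-assoc; ∨-comm; ∨-identityʳ)
open import Data.Fin.Base using (Fin; zero; suc; toℕ)
open import Data.Fin.Patterns using (0F; 1F; 2F)
open import Data.Fin.Permutation as Perm using (Permutation; _⟨$⟩ʳ_; _⟨$⟩ˡ_; _∘ₚ_)
open import Data.Fin.Properties using (any?; _≟_)
open import Data.Fin.Subset using (_∈_; ⁅_⁆)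
open import Data.Fin.Subset.Properties
  using (_∈?_; x∈⁅x⁆; x∈⁅y⁆⇒x≡y; x∈⁅y⁆⇔x≡y; ∣⁅x⁆∣≡1)
import Data.Integer.Base as ℤ
import Data.Integer.Properties as ℤ
open import Data.List.Base
  using (List; []; _∷_; _++_; map; filter; length; tabulate; allFin; cartesianProduct)
open import Data.List.Properties using (map-++; map-∘; map-tabulate)
open import Data.List.Relation.Unary.All using (universal)
import Data.List.Relation.Unary.All.Properties as All
import Data.List.Relation.Unary.Unique.Propositional.Properties as Unique
open import Data.Nat.Base as ℕ
  using (ℕ; NonZero; zero; suc; _+_; _∸_; _*_; _^_; _<_; z≤n; s≤s; _⊓_; _≤ᵇ_; _<ᵇ_)
open import Data.Nat.DivMod as DivMod using (_%_; m≡m%n+[m/n]*n; m%n<n; m<n*o⇒m/o<n)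
open import Data.Nat.ListAction using () renaming (sum to sumᴸ)
open import Data.Nat.ListAction.Properties using (sum-++)
open import Data.Nat.Properties as ℕₚ using (+-0-commutativeMonoid; +-*-semiring; module ≤-Reasoning)
open import Algebra.Properties.CommutativeMonoid.Sum +-0-commutativeMonoid
  using (sum; sum-cong-≗; sum-permute; ∑-distrib-+; ∑-comm)
open import Algebra.Properties.Semiring.Sum +-*-semiring using (*-distribˡ-sum)
open import Data.Nat.Tactic.RingSolver using (solve-∀)
open import Data.Product.Base using (∃-syntax; Σ-syntax; _×_; _,_; proj₁; proj₂)
import Data.Rational.Unnormalised.Properties as ℚᵘ
open import Data.Sum.Base as Sum using (_⊎_; inj₁; inj₂)
open import Function.Base using (_∘_; id)
open import Relation.Binary.PropositionalEquality
  using (_≡_; _≗_; refl; sym; trans; cong; cong₂; subst; subst₂; module ≡-Reasoning)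
open import Relation.Nullary using (Dec; yes; no; does; contradiction)
open import Relation.Nullary.Decidable using (dec-true; dec-false; does-⇔; _×-dec_)

private variable
  n : ℕ

-- Finite sums of natural numbers and Kronecker deltas

sum-mono-≤ : {f g : Fin n → ℕ} → (∀ i → f i ℕ.≤ g i) → sum f ℕ.≤ sum g
sum-mono-≤ {zero}  f≤g = z≤n
sum-mono-≤ {suc n} f≤g = ℕₚ.+-mono-≤ (f≤g zero) (sum-mono-≤ (f≤g ∘ suc))

sum-mono-< : {f g : Fin n → ℕ} → (∀ i → f i ℕ.≤ g i) → ∀ i → f i < g i → sum f < sum g
sum-mono-< f≤g zero    fi<gi = ℕₚ.+-mono-<-≤ fi<gi (sum-mono-≤ (f≤g ∘ suc))
sum-mono-< f≤g (suc i) fi<gi = ℕₚ.+-mono-≤-< (f≤g zero) (sum-mono-< (f≤g ∘ suc) i fi<gi)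

sum-<⇒∃< : (f g : Fin n → ℕ) → sum f < sum g → ∃[ i ] f i < g i
sum-<⇒∃< f g ∑f<∑g with any? (λ i → f i ℕₚ.<? g i)
... | yes ∃i = ∃i
... | no  ∄i = contradiction ∑f<∑g (ℕₚ.≤⇒≯ (sum-mono-≤ λ i → ℕₚ.≮⇒≥ λ fi<gi → ∄i (i , fi<gi)))

-- Otherwise `f` dominates `g` everywhere and strictly at `i`, which makes its sum strictly larger.
sum-compensate : (f g : Fin n → ℕ) → sum f ℕ.≤ sum g → ∀ i → g i < f i → ∃[ j ] f j < g j
sum-compensate f g ∑f≤∑g i gi<fi with any? (λ j → f j ℕₚ.<? g j)
... | yes ∃j = ∃j
... | no  ∄j = contradiction (sum-mono-< (λ j → ℕₚ.≮⇒≥ λ fj<gj → ∄j (j , fj<gj)) i gi<fi)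
                 (ℕₚ.≤⇒≯ ∑f≤∑g)

sum-zero : ∀ n → sum {n} (λ _ → 0) ≡ 0
sum-zero zero    = refl
sum-zero (suc n) = sum-zero n

Σ₂ : (Fin n → Fin n → ℕ) → ℕ
Σ₂ f = sum λ i → sum (f i)

Σ₂-cong : {f g : Fin n → Fin n → ℕ} → (∀ i j → f i j ≡ g i j) → Σ₂ f ≡ Σ₂ g
Σ₂-cong f≗g = sum-cong-≗ λ i → sum-cong-≗ (f≗g i)

Σ₂-mono-≤ : {f g : Fin n → Fin n → ℕ} → (∀ i j → f i j ℕ.≤ g i j) → Σ₂ f ℕ.≤ Σ₂ g
Σ₂-mono-≤ f≤g = sum-mono-≤ λ i → sum-mono-≤ (f≤g i)

Σ₂-distrib-+ : (f g : Fin n → Fin n → ℕ) → Σ₂ (λ i j → f i j + g i j) ≡ Σ₂ f + Σ₂ g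
Σ₂-distrib-+ f g = trans (sum-cong-≗ λ i → ∑-distrib-+ (f i) (g i))
                         (∑-distrib-+ (λ i → sum (f i)) (λ i → sum (g i)))

Σ₂-balance : (f g h k : Fin n → Fin n → ℕ) → (∀ i j → f i j + g i j ≡ h i j + k i j) →
             Σ₂ f + Σ₂ g ≡ Σ₂ h + Σ₂ k
Σ₂-balance f g h k eq =
  trans (sym (Σ₂-distrib-+ f g)) (trans (Σ₂-cong eq) (Σ₂-distrib-+ h k))

⟦_⟧ : Bool → ℕ
⟦ true  ⟧ = 1
⟦ false ⟧ = 0

δ : Fin n → Fin n → ℕ
δ i j = ⟦ does (i ≟ j) ⟧

sum-δ : (i : Fin n) (f : Fin n → ℕ) → sum (λ j → δ i j * f j) ≡ f i
sum-δ {suc n} zero f = trans (cong₂ _+_ (ℕₚ.+-identityʳ (f zero)) (sum-zero n)) (ℕₚ.+-identityʳ (f zero))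
sum-δ (suc i) f = sum-δ i (f ∘ suc)

-- Hyperedges and flips

-- The edge set is a 0/1-valued function, so that degrees are double sums. The summation variables
-- follow the cyclic order x, y, z; hence `rotate` only renames fields, and an operation defined on
-- the first class is available for all three.
record Realization (d₁ d₂ d₃ : Fin n → ℕ) : Set where
  field
    edge   : Fin n → Fin n → Fin n → ℕ
    edge≤1 : ∀ x y z → edge x y z ℕ.≤ 1
    deg₁   : ∀ x → Σ₂ (λ y z → edge x y z) ≡ d₁ x
    deg₂   : ∀ y → Σ₂ (λ z x → edge x y z) ≡ d₂ y
    deg₃   : ∀ z → Σ₂ (λ x y → edge x y z) ≡ d₃ z

open Realization

rotate : {d₁ d₂ d₃ : Fin n → ℕ} → Realization d₁ d₂ d₃ → Realization d₂ d₃ d₁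
rotate R = record
  { edge   = λ y z x → edge R x y z
  ; edge≤1 = λ y z x → edge≤1 R x y z
  ; deg₁   = deg₂ R
  ; deg₂   = deg₃ R
  ; deg₃   = deg₁ R
  }

cast-deg₁ : {d₁ d₁′ d₂ d₃ : Fin n → ℕ} → d₁ ≗ d₁′ → Realization d₁ d₂ d₃ → Realization d₁′ d₂ d₃
cast-deg₁ d₁≗d₁′ R = record
  { edge   = edge R
  ; edge≤1 = edge≤1 R
  ; deg₁   = λ x → trans (deg₁ R x) (d₁≗d₁′ x)
  ; deg₂   = deg₂ R
  ; deg₃   = deg₃ R
  }

-- One unit of degree passes from `i` to `j`; adding a delta on each side avoids truncated
-- subtraction.
Flip : (d d′ : Fin n → ℕ) → Set
Flip d d′ = ∃[ i ] ∃[ j ] d j < d i × (∀ x → d′ x + δ i x ≡ d x + δ j x)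

-- Edge values are at most 1, so `i y₀ z₀` is an edge and `j y₀ z₀` is not; the first is replaced by
-- the second. Both contain `y₀` and `z₀`, so the degrees in the other two classes stay the same.
flip-at : {d₁ d₁′ d₂ d₃ : Fin n → ℕ} (R : Realization d₁ d₂ d₃) → ∀ i j y₀ z₀ →
          edge R j y₀ z₀ < edge R i y₀ z₀ → (∀ x → d₁′ x + δ i x ≡ d₁ x + δ j x) →
          Realization d₁′ d₂ d₃
flip-at {n} {d₁} {d₁′} R i j y₀ z₀ gj<gi bal = record
  { edge   = edge′
  ; edge≤1 = edge′≤1
  ; deg₁   = λ x → ℕₚ.+-cancelʳ-≡ (δ i x) _ _ (begin
      Σ₂ (λ y z → edge′ x y z) + δ i x                ≡⟨ cong (Σ₂ (λ y z → edge′ x y z) +_) (Σ₂-unit (δ i x)) ⟨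
      Σ₂ (λ y z → edge′ x y z) + Σ₂ (λ y z → e i x y z) ≡⟨ Σ₂-balance _ _ _ _ (λ y z → edge′-bal x y z) ⟩
      Σ₂ (λ y z → edge R x y z) + Σ₂ (λ y z → e j x y z) ≡⟨ cong₂ _+_ (deg₁ R x) (Σ₂-unit (δ j x)) ⟩
      d₁ x + δ j x                                    ≡⟨ bal x ⟨
      d₁′ x + δ i x                                   ∎)
  ; deg₂   = λ y → ℕₚ.+-cancelʳ-≡ (Σ₂ (λ z x → e i x y z)) _ _
      (trans (Σ₂-balance _ _ _ _ (λ z x → edge′-bal x y z))
             (cong₂ _+_ (deg₂ R y) (trans (Σ₂-e₂ j y) (sym (Σ₂-e₂ i y)))))
  ; deg₃   = λ z → ℕₚ.+-cancelʳ-≡ (Σ₂ (λ x y → e i x y z)) _ _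
      (trans (Σ₂-balance _ _ _ _ (λ x y → edge′-bal x y z))
             (cong₂ _+_ (deg₃ R z) (trans (Σ₂-e₃ j z) (sym (Σ₂-e₃ i z)))))
  }
  where
  open ≡-Reasoning
  e : Fin n → Fin n → Fin n → Fin n → ℕ
  e k x y z = δ k x * (δ y₀ y * δ z₀ z)

  edge′ : Fin n → Fin n → Fin n → ℕ
  edge′ x y z = edge R x y z ∸ e i x y z + e j x y z

  e≤edge : ∀ x y z → e i x y z ℕ.≤ edge R x y z
  e≤edge x y z with i ≟ x | y₀ ≟ y | z₀ ≟ z
  ... | no _     | _        | _        = z≤n
  ... | yes _    | no _     | _        = z≤n
  ... | yes _    | yes _    | no _     = z≤n
  ... | yes refl | yes refl | yes refl = ℕₚ.≤-trans (s≤s z≤n) gj<gi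

  edge′-bal : ∀ x y z → edge′ x y z + e i x y z ≡ edge R x y z + e j x y z
  edge′-bal x y z = trans (swap (edge R x y z ∸ e i x y z) (e j x y z) (e i x y z))
                          (cong (_+ e j x y z) (ℕₚ.m∸n+n≡m (e≤edge x y z)))
    where
    swap : ∀ a b c → a + b + c ≡ a + c + b
    swap = solve-∀

  vacant : ∀ x y z → e j x y z ≡ 0 ⊎ (e j x y z ≡ 1 × edge R x y z ≡ 0)
  vacant x y z with j ≟ x | y₀ ≟ y | z₀ ≟ z
  ... | no _     | _        | _        = inj₁ refl
  ... | yes _    | no _     | _        = inj₁ refl
  ... | yes _    | yes _    | no _     = inj₁ refl
  ... | yes refl | yes refl | yes refl =
    inj₂ (refl , ℕₚ.n<1⇒n≡0 (ℕₚ.<-≤-trans gj<gi (edge≤1 R i y z)))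

  edge′≤1 : ∀ x y z → edge′ x y z ℕ.≤ 1
  edge′≤1 x y z with vacant x y z
  ... | inj₁ e≡0 rewrite e≡0 | ℕₚ.+-identityʳ (edge R x y z ∸ e i x y z) =
    ℕₚ.≤-trans (ℕₚ.m∸n≤m (edge R x y z) (e i x y z)) (edge≤1 R x y z)
  ... | inj₂ (e≡1 , g≡0) rewrite e≡1 | g≡0 | ℕₚ.0∸n≡0 (e i x y z) = ℕₚ.≤-refl

  Σ₂-unit : ∀ c → Σ₂ (λ y z → c * (δ y₀ y * δ z₀ z)) ≡ c
  Σ₂-unit c = begin
    Σ₂ (λ y z → c * (δ y₀ y * δ z₀ z))            ≡⟨ Σ₂-cong (λ y z → shuffle c (δ y₀ y) (δ z₀ z)) ⟩
    Σ₂ (λ y z → δ z₀ z * (δ y₀ y * c))            ≡⟨ sum-cong-≗ (λ y → sum-δ z₀ (λ _ → δ y₀ y * c)) ⟩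
    sum (λ y → δ y₀ y * c)                        ≡⟨ sum-δ y₀ (λ _ → c) ⟩
    c                                             ∎
    where
    shuffle : ∀ a b c → a * (b * c) ≡ c * (b * a)
    shuffle = solve-∀

  Σ₂-e₂ : ∀ k y → Σ₂ (λ z x → e k x y z) ≡ sum (λ z → δ y₀ y * δ z₀ z)
  Σ₂-e₂ k y = sum-cong-≗ λ z → sum-δ k (λ _ → δ y₀ y * δ z₀ z)

  Σ₂-e₃ : ∀ k z → Σ₂ (λ x y → e k x y z) ≡ sum (λ y → δ y₀ y * δ z₀ z)
  Σ₂-e₃ k z = trans (sum-cong-≗ λ x → sym (*-distribˡ-sum (δ k x) (λ y → δ y₀ y * δ z₀ z)))
                    (sum-δ k (λ _ → sum λ y → δ y₀ y * δ z₀ z))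

-- As `j` has smaller degree than `i`, some pair `y₀`, `z₀` forms an edge with `i` but not with `j`;
-- comparing sums twice finds first `y₀`, then `z₀`.
flip : {d₁ d₁′ d₂ d₃ : Fin n → ℕ} → Flip d₁ d₁′ → Realization d₁ d₂ d₃ → Realization d₁′ d₂ d₃
flip (i , j , dj<di , bal) R with sum-<⇒∃< _ _ (subst₂ _<_ (sym (deg₁ R j)) (sym (deg₁ R i)) dj<di)
... | y₀ , row< with sum-<⇒∃< _ _ row<
... | z₀ , cell< = flip-at R i j y₀ z₀ cell< bal

-- Rebalancing the degrees within one class

module Shift (d D : Fin n → ℕ) {i j : Fin n} (Di<di : D i < d i) (dj<Dj : d j < D j) where

  shift : Fin n → ℕ
  shift x = d x ∸ δ i x + δ j x

  shift-bal : ∀ x → shift x + δ i x ≡ d x + δ j x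
  shift-bal x = trans (swap (d x ∸ δ i x) (δ j x) (δ i x)) (cong (_+ δ j x) (ℕₚ.m∸n+n≡m δ≤d))
    where
    swap : ∀ a b c → a + b + c ≡ a + c + b
    swap = solve-∀
    δ≤d : δ i x ℕ.≤ d x
    δ≤d with i ≟ x
    ... | yes refl = ℕₚ.≤-trans (s≤s z≤n) Di<di
    ... | no  _    = z≤n

  -- With `w` the indicator of a block: a flip between two vertices that are both inside or both
  -- outside the block preserves its total degree, hence any bound on that total.
  sum-shift : (w : Fin n → ℕ) → w i ≡ w j → sum (λ x → w x * shift x) ≡ sum (λ x → w x * d x)
  sum-shift w wi≡wj = ℕₚ.+-cancelʳ-≡ (w i) _ _ (begin
    sum (λ x → w x * shift x) + w i                            ≡⟨ expand shift i ⟨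
    sum (λ x → w x * (shift x + δ i x))                        ≡⟨ sum-cong-≗ (λ x → cong (w x *_) (shift-bal x)) ⟩
    sum (λ x → w x * (d x + δ j x))                            ≡⟨ expand d j ⟩
    sum (λ x → w x * d x) + w j                                ≡⟨ cong (sum (λ x → w x * d x) +_) wi≡wj ⟨
    sum (λ x → w x * d x) + w i                                ∎)
    where
    open ≡-Reasoning
    expand : ∀ f k → sum (λ x → w x * (f x + δ k x)) ≡ sum (λ x → w x * f x) + w k
    expand f k = begin
      sum (λ x → w x * (f x + δ k x))                          ≡⟨ sum-cong-≗ (λ x → dist (w x) (f x) (δ k x)) ⟩
      sum (λ x → w x * f x + δ k x * w x)                      ≡⟨ ∑-distrib-+ (λ x → w x * f x) (λ x → δ k x * w x) ⟩
      sum (λ x → w x * f x) + sum (λ x → δ k x * w x)          ≡⟨ cong (sum (λ x → w x * f x) +_) (sum-δ k w) ⟩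
      sum (λ x → w x * f x) + w k                              ∎
      where
      dist : ∀ a b c → a * (b + c) ≡ a * b + c * a
      dist = solve-∀

  sum-shift₁ : sum shift ≡ sum d
  sum-shift₁ = begin
    sum shift                  ≡⟨ sum-cong-≗ (λ x → ℕₚ.*-identityˡ (shift x)) ⟨
    sum (λ x → 1 * shift x)    ≡⟨ sum-shift (λ _ → 1) refl ⟩
    sum (λ x → 1 * d x)        ≡⟨ sum-cong-≗ (λ x → ℕₚ.*-identityˡ (d x)) ⟩
    sum d                      ∎
    where open ≡-Reasoning

  shift-≤ : ∀ x → d x ℕ.≤ D x → shift x ℕ.≤ D x
  shift-≤ x dx≤Dx with j ≟ x
  ... | yes refl = ℕₚ.≤-trans (ℕₚ.+-monoˡ-≤ 1 (ℕₚ.m∸n≤m (d x) (δ i x))) (subst (ℕ._≤ D x) (ℕₚ.+-comm 1 (d x)) dj<Dj)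
  ... | no  _    = ℕₚ.≤-trans (ℕₚ.≤-reflexive (ℕₚ.+-identityʳ _)) (ℕₚ.≤-trans (ℕₚ.m∸n≤m (d x) (δ i x)) dx≤Dx)

  shift-≥ : ∀ x → D x ℕ.≤ d x → D x ℕ.≤ shift x
  shift-≥ x Dx≤dx = ℕₚ.≤-trans kept (ℕₚ.m≤m+n (d x ∸ δ i x) (δ j x))
    where
    kept : D x ℕ.≤ d x ∸ δ i x
    kept with i ≟ x
    ... | yes refl = ℕₚ.∸-monoˡ-≤ 1 Di<di
    ... | no  _    = Dx≤dx

  -- The total excess over `D` is the termination measure of `rebalance`: `i` loses one unit of
  -- excess, while `j`, being in deficit, gains none.
  shift-∸ : sum (λ x → shift x ∸ D x) < sum (λ x → d x ∸ D x)
  shift-∸ = sum-mono-< below i strict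
    where
    below : ∀ x → shift x ∸ D x ℕ.≤ d x ∸ D x
    below x with ℕₚ.≤-total (d x) (D x)
    ... | inj₁ dx≤Dx = subst (ℕ._≤ d x ∸ D x) (sym (ℕₚ.m≤n⇒m∸n≡0 (shift-≤ x dx≤Dx))) z≤n
    ... | inj₂ Dx≤dx with j ≟ x
    ...   | yes refl = contradiction dj<Dj (ℕₚ.≤⇒≯ Dx≤dx)
    ...   | no  _    = ℕₚ.∸-monoˡ-≤ (D x) (ℕₚ.≤-trans (ℕₚ.≤-reflexive (ℕₚ.+-identityʳ _)) (ℕₚ.m∸n≤m (d x) (δ i x)))
    shift-i : suc (shift i) ≡ d i
    shift-i = begin
      suc (shift i)     ≡⟨ ℕₚ.+-comm 1 (shift i) ⟩
      shift i + 1       ≡⟨ cong (λ t → shift i + ⟦ t ⟧) (dec-true (i ≟ i) refl) ⟨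
      shift i + δ i i   ≡⟨ shift-bal i ⟩
      d i + δ j i       ≡⟨ cong (λ t → d i + ⟦ t ⟧) (dec-false (j ≟ i) λ { refl → ℕₚ.<-asym Di<di dj<Dj }) ⟩
      d i + 0           ≡⟨ ℕₚ.+-identityʳ (d i) ⟩
      d i               ∎
      where open ≡-Reasoning
    strict : shift i ∸ D i < d i ∸ D i
    strict = ℕₚ.∸-monoˡ-< (ℕₚ.≤-reflexive shift-i) (shift-≥ i (ℕₚ.<⇒≤ Di<di))

sum-compensate-on : {P : Fin n → Set} (P? : ∀ i → Dec (P i)) (f g : Fin n → ℕ) →
  sum (λ i → ⟦ does (P? i) ⟧ * f i) ℕ.≤ sum (λ i → ⟦ does (P? i) ⟧ * g i) →
  ∀ i → P i → g i < f i → ∃[ j ] P j × f j < g j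
sum-compensate-on P? f g ∑≤ i Pi gi<fi with sum-compensate _ _ ∑≤ i at-i
  where
  at-i : ⟦ does (P? i) ⟧ * g i < ⟦ does (P? i) ⟧ * f i
  at-i with P? i
  ... | yes _  = ℕₚ.+-monoˡ-< 0 gi<fi
  ... | no ¬Pi = contradiction Pi ¬Pi
... | j , lt with P? j
...   | yes Pj = j , Pj , ℕₚ.+-cancelʳ-< 0 _ _ lt
...   | no  _  = contradiction lt λ ()

module Rebalance {n m M b : ℕ} (D : Fin n → ℕ)
  (ascending : ∀ i j → toℕ i ℕ.≤ toℕ j → D i ℕ.≤ D j)
  (m≤D : ∀ i → m ℕ.≤ D i) (D≤M : ∀ i → D i ℕ.≤ M)
  {d₂ d₃ : Fin n → ℕ} where

  -- The vertex `b` lies in neither block. This leaves room for the one vertex that changes sides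
  -- between two consecutive layers.
  low? : (i : Fin n) → Dec (toℕ i < b)
  low? i = toℕ i ℕₚ.<? b

  high? : (i : Fin n) → Dec (b < toℕ i)
  high? i = b ℕₚ.<? toℕ i

  low high : Fin n → ℕ
  low  i = ⟦ does (low? i) ⟧
  high i = ⟦ does (high? i) ⟧

  LowBound HighBound : (Fin n → ℕ) → Set
  LowBound  d = sum (λ i → low i * d i) ℕ.≤ sum (λ i → low i * m)
  HighBound d = sum (λ i → high i * M) ℕ.≤ sum (λ i → high i * d i)

  -- A block carries its sum bound until all its flips are made. Afterwards it may exchange degree
  -- with the rest, which can break the bound but not `LowDone` or `HighDone`, since a shift never
  -- overshoots `D`.
  LowDone HighDone : (Fin n → ℕ) → Set
  LowDone  d = ∀ i → toℕ i < b → d i ℕ.≤ D i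
  HighDone d = ∀ i → b < toℕ i → D i ℕ.≤ d i

  low-low : ∀ {i j} → toℕ i < b → toℕ j < b → low i ≡ low j
  low-low i<b j<b = trans (cong ⟦_⟧ (dec-true (low? _) i<b)) (sym (cong ⟦_⟧ (dec-true (low? _) j<b)))

  high-high : ∀ {i j} → b < toℕ i → b < toℕ j → high i ≡ high j
  high-high b<i b<j = trans (cong ⟦_⟧ (dec-true (high? _) b<i)) (sym (cong ⟦_⟧ (dec-true (high? _) b<j)))

  high-low : ∀ {i j} → toℕ i < b → toℕ j < b → high i ≡ high j
  high-low i<b j<b = trans (cong ⟦_⟧ (dec-false (high? _) (ℕₚ.<-asym i<b)))
                           (sym (cong ⟦_⟧ (dec-false (high? _) (ℕₚ.<-asym j<b))))

  -- As long as a low vertex has excess degree, some low vertex has degree below m ≤ D, and one can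
  -- flip inside the low block; dually for the high block.  Afterwards D i ≥ D j whenever i has
  -- excess and j has deficit, because D is ascending.
  rebalance : ∀ fuel (d : Fin n → ℕ) → sum (λ i → d i ∸ D i) < fuel → sum d ≡ sum D →
              LowBound d ⊎ LowDone d → HighBound d ⊎ HighDone d →
              Realization d d₂ d₃ → Realization D d₂ d₃
  rebalance (suc fuel) d (s≤s ∑≤) ∑≡ lowInv highInv R
    with any? (λ i → low? i ×-dec (D i ℕₚ.<? d i)) | lowInv
  ... | yes (i , i<b , Di<di) | inj₂ done = contradiction Di<di (ℕₚ.≤⇒≯ (done i i<b))
  ... | yes (i , i<b , Di<di) | inj₁ bound
    with sum-compensate-on low? d (λ _ → m) bound i i<b (ℕₚ.≤-<-trans (m≤D i) Di<di)
  ...   | j , j<b , dj<m =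
    rebalance fuel shift (ℕₚ.<-≤-trans shift-∸ ∑≤) (trans sum-shift₁ ∑≡)
      (inj₁ (subst (ℕ._≤ _) (sym (sum-shift low (low-low i<b j<b))) bound))
      (Sum.map (subst (_ ℕ.≤_) (sym (sum-shift high (high-low i<b j<b))))
               (λ done x b<x → shift-≥ x (done x b<x)) highInv)
      (flip (i , j , ℕₚ.<-trans dj<m (ℕₚ.≤-<-trans (m≤D i) Di<di) , shift-bal) R)
    where open Shift d D Di<di (ℕₚ.<-≤-trans dj<m (m≤D j))
  rebalance (suc fuel) d (s≤s ∑≤) ∑≡ lowInv highInv R
    | no ∄excess | _
    with any? (λ j → high? j ×-dec (d j ℕₚ.<? D j)) | highInv
  ... | yes (j , b<j , dj<Dj) | inj₂ done = contradiction dj<Dj (ℕₚ.≤⇒≯ (done j b<j))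
  ... | yes (j , b<j , dj<Dj) | inj₁ bound
    with sum-compensate-on high? (λ _ → M) d bound j b<j (ℕₚ.<-≤-trans dj<Dj (D≤M j))
  ...   | i , b<i , M<di =
    rebalance fuel shift (ℕₚ.<-≤-trans shift-∸ ∑≤) (trans sum-shift₁ ∑≡)
      (inj₂ λ x x<b → shift-≤ x (ℕₚ.≮⇒≥ λ lt → ∄excess (x , x<b , lt)))
      (inj₁ (subst (_ ℕ.≤_) (sym (sum-shift high (high-high b<i b<j))) bound))
      (flip (i , j , ℕₚ.<-trans (ℕₚ.<-≤-trans dj<Dj (D≤M j)) M<di , shift-bal) R)
    where open Shift d D (ℕₚ.≤-<-trans (D≤M i) M<di) dj<Dj
  rebalance (suc fuel) d (s≤s ∑≤) ∑≡ lowInv highInv R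
    | no ∄excess | _ | no ∄deficit | _
    with any? (λ i → D i ℕₚ.<? d i)
  ... | no d≤D = cast-deg₁ d≡D R
    where
    d≡D : d ≗ D
    d≡D i with ℕₚ.m≤n⇒m<n∨m≡n (ℕₚ.≮⇒≥ λ lt → d≤D (i , lt))
    ... | inj₂ eq = eq
    ... | inj₁ di<Di = contradiction ∑≡ (ℕₚ.<⇒≢ (sum-mono-< (λ x → ℕₚ.≮⇒≥ λ lt → d≤D (x , lt)) i di<Di))
  ... | yes (i , Di<di) with sum-compensate d D (ℕₚ.≤-reflexive ∑≡) i Di<di
  ...   | j , dj<Dj =
    rebalance fuel shift (ℕₚ.<-≤-trans shift-∸ ∑≤) (trans sum-shift₁ ∑≡)
      (inj₂ λ x x<b → shift-≤ x (ℕₚ.≮⇒≥ λ lt → ∄excess (x , x<b , lt)))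
      (inj₂ λ x b<x → shift-≥ x (ℕₚ.≮⇒≥ λ lt → ∄deficit (x , b<x , lt)))
      (flip (i , j , ℕₚ.<-trans dj<Dj (ℕₚ.≤-<-trans (ascending j i (ℕₚ.≤-trans j≤b b≤i)) Di<di) , shift-bal) R)
    where
    open Shift d D Di<di dj<Dj
    j≤b : toℕ j ℕ.≤ b
    j≤b = ℕₚ.≮⇒≥ λ b<j → ∄deficit (j , b<j , dj<Dj)
    b≤i : b ℕ.≤ toℕ i
    b≤i = ℕₚ.≮⇒≥ λ i<b → ∄excess (i , i<b , Di<di)

-- Hypergraphs between two given ones

-- A discrete intermediate value argument: either the head stays at `lo` and the tail absorbs the
-- rest of `S`, or the tail is filled up to `hi` and the head takes the remainder.
interpolate : (lo hi : Fin n → ℕ) → (∀ i → lo i ℕ.≤ hi i) →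
              ∀ S → sum lo ℕ.≤ S → S ℕ.≤ sum hi →
              ∃[ f ] (∀ i → lo i ℕ.≤ f i) × (∀ i → f i ℕ.≤ hi i) × sum f ≡ S
interpolate {zero}  lo hi lo≤hi S _ S≤0 = (λ ()) , (λ ()) , (λ ()) , sym (ℕₚ.n≤0⇒n≡0 S≤0)
interpolate {suc n} lo hi lo≤hi S ∑lo≤S S≤∑hi with ℕₚ.≤-total S (lo zero + sum (hi ∘ suc))
... | inj₁ S≤ with interpolate (lo ∘ suc) (hi ∘ suc) (lo≤hi ∘ suc) (S ∸ lo zero)
                     (ℕₚ.m+n≤o⇒m≤o∸n _ (subst (ℕ._≤ S) (ℕₚ.+-comm (lo zero) _) ∑lo≤S))
                     (ℕₚ.m≤n+o⇒m∸n≤o S (lo zero) S≤)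
...   | f , lo≤f , f≤hi , ∑f =
  (λ { zero → lo zero ; (suc i) → f i }) ,
  (λ { zero → ℕₚ.≤-refl ; (suc i) → lo≤f i }) ,
  (λ { zero → lo≤hi zero ; (suc i) → f≤hi i }) ,
  trans (cong (lo zero +_) ∑f) (ℕₚ.m+[n∸m]≡n (ℕₚ.≤-trans (ℕₚ.m≤m+n (lo zero) _) ∑lo≤S))
interpolate {suc n} lo hi lo≤hi S ∑lo≤S S≤∑hi
    | inj₂ S≥ =
  (λ { zero → S ∸ sum (hi ∘ suc) ; (suc i) → hi (suc i) }) ,
  (λ { zero → ℕₚ.m+n≤o⇒m≤o∸n _ S≥ ; (suc i) → lo≤hi (suc i) }) ,
  (λ { zero → ℕₚ.m≤n+o⇒m∸n≤o S _ (subst (S ℕ.≤_) (ℕₚ.+-comm (hi zero) _) S≤∑hi) ; (suc i) → ℕₚ.≤-refl }) ,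
  ℕₚ.m∸n+n≡m (ℕₚ.≤-trans (ℕₚ.m≤n+m _ (lo zero)) S≥)

Σ₃ : (Fin n → Fin n → Fin n → ℕ) → ℕ
Σ₃ f = sum λ x → Σ₂ (f x)

Σ₃-rotate : (f : Fin n → Fin n → Fin n → ℕ) → Σ₃ (λ y z x → f x y z) ≡ Σ₃ f
Σ₃-rotate f = sym (trans (∑-comm λ x y → sum (f x y)) (sum-cong-≗ λ y → ∑-comm λ x z → f x y z))

-- Three nested interpolations distribute `S` over the planes, each plane over its rows, and each
-- row over its cells.
interpolate₃ : (lo hi : Fin n → Fin n → Fin n → ℕ) → (∀ x y z → lo x y z ℕ.≤ hi x y z) →
               ∀ S → Σ₃ lo ℕ.≤ S → S ℕ.≤ Σ₃ hi →
               ∃[ f ] (∀ x y z → lo x y z ℕ.≤ f x y z) × (∀ x y z → f x y z ℕ.≤ hi x y z) × Σ₃ f ≡ S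
interpolate₃ lo hi lo≤hi S lo≤S S≤hi
  with interpolate _ _ (λ x → Σ₂-mono-≤ (lo≤hi x)) S lo≤S S≤hi
... | s , lo≤s , s≤hi , ∑s = (λ x → proj₁ (plane x)) , (λ x y → proj₁ (proj₂ (line x y))) ,
      (λ x y → proj₁ (proj₂ (proj₂ (line x y)))) ,
      trans (sum-cong-≗ λ x → trans (sum-cong-≗ λ y → proj₂ (proj₂ (proj₂ (line x y))))
                                    (proj₂ (proj₂ (proj₂ (rows x))))) ∑s
  where
  rows : ∀ x → ∃[ r ] (∀ y → sum (lo x y) ℕ.≤ r y) × (∀ y → r y ℕ.≤ sum (hi x y)) × sum r ≡ s x
  rows x = interpolate _ _ (λ y → sum-mono-≤ (lo≤hi x y)) (s x) (lo≤s x) (s≤hi x)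
  line : ∀ x y → ∃[ f ] (∀ z → lo x y z ℕ.≤ f z) × (∀ z → f z ℕ.≤ hi x y z) × sum f ≡ proj₁ (rows x) y
  line x y = interpolate _ _ (lo≤hi x y) (proj₁ (rows x) y)
               (proj₁ (proj₂ (rows x)) y) (proj₁ (proj₂ (proj₂ (rows x))) y)
  plane : ∀ x → ∃[ f ] (∀ y → sum (f y) ≡ proj₁ (rows x) y)
  plane x = (λ y → proj₁ (line x y)) , (λ y → proj₂ (proj₂ (proj₂ (line x y))))

record Target (m M S : ℕ) (D : Fin n → ℕ) : Set where
  field
    ascending : ∀ i j → toℕ i ℕ.≤ toℕ j → D i ℕ.≤ D j
    lower     : ∀ i → m ℕ.≤ D i
    upper     : ∀ i → D i ℕ.≤ M
    total     : sum D ≡ S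

open Target

module _ {n m M S b : ℕ} (A B : Fin n → Fin n → Fin n → ℕ)
  (A≤B : ∀ x y z → A x y z ℕ.≤ B x y z) (B≤1 : ∀ x y z → B x y z ℕ.≤ 1)
  (A-cyc : ∀ x y z → A x y z ≡ A y z x) (B-cyc : ∀ x y z → B x y z ≡ B y z x)
  (A≤S : Σ₃ A ℕ.≤ S) (S≤B : S ℕ.≤ Σ₃ B)
  (highA : sum {n} (λ x → ⟦ b <ᵇ toℕ x ⟧ * M) ℕ.≤ sum (λ x → ⟦ b <ᵇ toℕ x ⟧ * Σ₂ (A x)))
  (lowB  : sum (λ x → ⟦ toℕ x <ᵇ b ⟧ * Σ₂ (B x)) ℕ.≤ sum {n} (λ x → ⟦ toℕ x <ᵇ b ⟧ * m))
  where

  private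
    weighted-mono : (w f g : Fin n → ℕ) → (∀ x → f x ℕ.≤ g x) →
                    sum (λ x → w x * f x) ℕ.≤ sum (λ x → w x * g x)
    weighted-mono w f g f≤g = sum-mono-≤ λ x → ℕₚ.*-monoʳ-≤ (w x) (f≤g x)

    between : {d D d₂ d₃ : Fin n → ℕ} → Target m M S D → sum d ≡ S →
              (∀ x → Σ₂ (A x) ℕ.≤ d x) → (∀ x → d x ℕ.≤ Σ₂ (B x)) →
              Realization d d₂ d₃ → Realization D d₂ d₃
    between {d} {D} tgt ∑d A≤d d≤B =
      -- The fuel is inferred to be one more than the total excess of `d`.
      Rebalance.rebalance D (ascending tgt) (lower tgt) (upper tgt) _ d ℕₚ.≤-refl
        (trans ∑d (sym (total tgt)))
        (inj₁ (ℕₚ.≤-trans (weighted-mono (λ x → ⟦ toℕ x <ᵇ b ⟧) _ _ d≤B) lowB))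
        (inj₁ (ℕₚ.≤-trans highA (weighted-mono (λ x → ⟦ b <ᵇ toℕ x ⟧) _ _ A≤d)))

  -- A hypergraph `G` between `A` and `B` with `S` edges inherits the low bound from `B` and the
  -- high bound from `A`. Flips in one class leave the degrees of the others as in `G`, so the
  -- classes are treated in turn; cyclic symmetry of `A` and `B` carries the bounds over to each
  -- class.
  sandwich : {D₁ D₂ D₃ : Fin n → ℕ} → Target m M S D₁ → Target m M S D₂ → Target m M S D₃ →
             Realization D₁ D₂ D₃
  sandwich tgt₁ tgt₂ tgt₃ with interpolate₃ A B A≤B S A≤S S≤B
  ... | G , A≤G , G≤B , ∑G =
    rotate (between tgt₃
        (trans (Σ₃-rotate (λ y z x → G x y z)) (trans (Σ₃-rotate G) ∑G))
        (λ z → Σ₂-mono-≤ λ x y → subst (ℕ._≤ G x y z) (trans (A-cyc x y z) (A-cyc y z x)) (A≤G x y z))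
        (λ z → Σ₂-mono-≤ λ x y → subst (G x y z ℕ.≤_) (trans (B-cyc x y z) (B-cyc y z x)) (G≤B x y z))
      (rotate (between tgt₂
        (trans (Σ₃-rotate G) ∑G)
        (λ y → Σ₂-mono-≤ λ z x → subst (ℕ._≤ G x y z) (A-cyc x y z) (A≤G x y z))
        (λ y → Σ₂-mono-≤ λ z x → subst (G x y z ℕ.≤_) (B-cyc x y z) (G≤B x y z))
      (rotate (between tgt₁ ∑G
        (λ x → Σ₂-mono-≤ (A≤G x)) (λ x → Σ₂-mono-≤ (G≤B x))
      (record
        { edge   = G
        ; edge≤1 = λ x y z → ℕₚ.≤-trans (G≤B x y z) (B≤1 x y z)
        ; deg₁   = λ _ → refl
        ; deg₂   = λ _ → refl
        ; deg₃   = λ _ → refl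
        }))))))

-- Counting in an initial segment of ℕ

-- The last summand is split off, so that sums over `d + b` are cut at `b` by induction on `d`.
Σ< : ℕ → (ℕ → ℕ) → ℕ
Σ< zero    f = 0
Σ< (suc n) f = Σ< n f + f n

sum≡Σ< : ∀ n (f : ℕ → ℕ) → sum {n} (f ∘ toℕ) ≡ Σ< n f
sum≡Σ< zero    f = refl
sum≡Σ< (suc n) f = trans (cong (f 0 +_) (sum≡Σ< n (f ∘ suc))) (shift n)
  where
  shift : ∀ n → f 0 + Σ< n (f ∘ suc) ≡ Σ< (suc n) f
  shift zero    = ℕₚ.+-comm (f 0) 0
  shift (suc n) = trans (sym (ℕₚ.+-assoc (f 0) _ _)) (cong (_+ f (suc n)) (shift n))

Σ<-cong : ∀ n {f g : ℕ → ℕ} → (∀ i → i < n → f i ≡ g i) → Σ< n f ≡ Σ< n g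
Σ<-cong zero    f≗g = refl
Σ<-cong (suc n) f≗g = cong₂ _+_ (Σ<-cong n λ i i<n → f≗g i (ℕₚ.m<n⇒m<1+n i<n)) (f≗g n ℕₚ.≤-refl)

Σ<-mono-≤ : ∀ n {f g : ℕ → ℕ} → (∀ i → i < n → f i ℕ.≤ g i) → Σ< n f ℕ.≤ Σ< n g
Σ<-mono-≤ zero    f≤g = z≤n
Σ<-mono-≤ (suc n) f≤g = ℕₚ.+-mono-≤ (Σ<-mono-≤ n λ i i<n → f≤g i (ℕₚ.m<n⇒m<1+n i<n)) (f≤g n ℕₚ.≤-refl)

Σ<-const : ∀ n c → Σ< n (λ _ → c) ≡ n * c
Σ<-const zero    c = refl
Σ<-const (suc n) c = trans (cong (_+ c) (Σ<-const n c)) (ℕₚ.+-comm (n * c) c)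

Σ<-distrib-+ : ∀ n (f g : ℕ → ℕ) → Σ< n (λ i → f i + g i) ≡ Σ< n f + Σ< n g
Σ<-distrib-+ zero    f g = refl
Σ<-distrib-+ (suc n) f g = trans (cong (_+ (f n + g n)) (Σ<-distrib-+ n f g))
  (interchange (Σ< n f) (Σ< n g) (f n) (g n))
  where
  interchange : ∀ a b c d → a + b + (c + d) ≡ a + c + (b + d)
  interchange = solve-∀

*-distribˡ-Σ< : ∀ n c (f : ℕ → ℕ) → Σ< n (λ i → c * f i) ≡ c * Σ< n f
*-distribˡ-Σ< zero    c f = sym (ℕₚ.*-zeroʳ c)
*-distribˡ-Σ< (suc n) c f = trans (cong (_+ c * f n) (*-distribˡ-Σ< n c f)) (sym (ℕₚ.*-distribˡ-+ c _ _))

*-distribʳ-Σ< : ∀ n c (f : ℕ → ℕ) → Σ< n (λ i → f i * c) ≡ Σ< n f * c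
*-distribʳ-Σ< zero    c f = refl
*-distribʳ-Σ< (suc n) c f = trans (cong (_+ f n * c) (*-distribʳ-Σ< n c f)) (sym (ℕₚ.*-distribʳ-+ c (Σ< n f) (f n)))

Σ<-comm : ∀ m n (f : ℕ → ℕ → ℕ) → Σ< m (λ i → Σ< n (f i)) ≡ Σ< n (λ j → Σ< m (λ i → f i j))
Σ<-comm zero    n f = sym (trans (Σ<-const n 0) (ℕₚ.*-zeroʳ n))
Σ<-comm (suc m) n f = trans (cong (_+ Σ< n (f m)) (Σ<-comm m n f)) (sym (Σ<-distrib-+ n _ (f m)))

<⇒<ᵇ≡true : ∀ {i j} → i < j → (i <ᵇ j) ≡ true
<⇒<ᵇ≡true {i} {j} = dec-true (i ℕₚ.<? j)

≤⇒<ᵇ≡false : ∀ {i j} → j ℕ.≤ i → (i <ᵇ j) ≡ false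
≤⇒<ᵇ≡false {i} {j} j≤i = dec-false (i ℕₚ.<? j) (ℕₚ.≤⇒≯ j≤i)

≤⇒≤ᵇ≡true : ∀ {i j} → i ℕ.≤ j → (i ≤ᵇ j) ≡ true
≤⇒≤ᵇ≡true {i} {j} = dec-true (i ℕₚ.≤? j)

<⇒≤ᵇ≡false : ∀ {i j} → j < i → (i ≤ᵇ j) ≡ false
<⇒≤ᵇ≡false {i} {j} j<i = dec-false (i ℕₚ.≤? j) (ℕₚ.<⇒≱ j<i)

Σ<-below : ∀ d b (f : ℕ → ℕ) → Σ< (d + b) (λ i → ⟦ i <ᵇ b ⟧ * f i) ≡ Σ< b f
Σ<-below zero    b f = Σ<-cong b λ i i<b →
  trans (cong (λ t → ⟦ t ⟧ * f i) (<⇒<ᵇ≡true i<b)) (ℕₚ.*-identityˡ (f i))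
Σ<-below (suc d) b f = trans
  (cong₂ _+_ (Σ<-below d b f) (cong (λ t → ⟦ t ⟧ * f (d + b)) (≤⇒<ᵇ≡false (ℕₚ.m≤n+m b d))))
  (ℕₚ.+-identityʳ _)

-- The step from `t ∸ s` to `suc t ∸ s` is 1 if `s ≤ t` and 0 otherwise, so the count telescopes.
-- The form with `c ∸ s` on the left lets consecutive intervals be chained.
Σ<-≤ᵇ : ∀ s c k → (c ∸ s) + Σ< k (λ i → ⟦ s ≤ᵇ c + i ⟧) ≡ (c + k) ∸ s
Σ<-≤ᵇ s c zero    = trans (ℕₚ.+-identityʳ _) (cong (_∸ s) (sym (ℕₚ.+-identityʳ c)))
Σ<-≤ᵇ s c (suc k) = begin
  (c ∸ s) + (Σ< k (λ i → ⟦ s ≤ᵇ c + i ⟧) + ⟦ s ≤ᵇ c + k ⟧)   ≡⟨ ℕₚ.+-assoc (c ∸ s) _ _ ⟨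
  (c ∸ s) + Σ< k (λ i → ⟦ s ≤ᵇ c + i ⟧) + ⟦ s ≤ᵇ c + k ⟧     ≡⟨ cong (_+ ⟦ s ≤ᵇ c + k ⟧) (Σ<-≤ᵇ s c k) ⟩
  (c + k ∸ s) + ⟦ s ≤ᵇ c + k ⟧                               ≡⟨ step (c + k) ⟩
  suc (c + k) ∸ s                                            ≡⟨ cong (_∸ s) (ℕₚ.+-suc c k) ⟨
  (c + suc k) ∸ s                                            ∎
  where
  open ≡-Reasoning
  step : ∀ t → (t ∸ s) + ⟦ s ≤ᵇ t ⟧ ≡ suc t ∸ s
  step t with s ℕₚ.≤? t
  ... | yes s≤t rewrite ≤⇒≤ᵇ≡true s≤t = trans (ℕₚ.+-comm _ 1) (sym (ℕₚ.+-∸-assoc 1 s≤t))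
  ... | no  s≰t rewrite <⇒≤ᵇ≡false (ℕₚ.≰⇒> s≰t) | ℕₚ.m≤n⇒m∸n≡0 (ℕₚ.<⇒≤ (ℕₚ.≰⇒> s≰t)) =
    sym (ℕₚ.m≤n⇒m∸n≡0 (ℕₚ.≰⇒> s≰t))

-- Szudzik's pairing function: the pairs with both entries below l have exactly the ranks below l².
rank : ℕ → ℕ → ℕ
rank i j = if i <ᵇ j then j * j + i else i * i + i + j

rank-< : ∀ {i j} → i < j → rank i j ≡ j * j + i
rank-< i<j rewrite <⇒<ᵇ≡true i<j = refl

rank-≥ : ∀ {i j} → j ℕ.≤ i → rank i j ≡ i * i + i + j
rank-≥ j≤i rewrite ≤⇒<ᵇ≡false j≤i = refl

rank-square : ∀ {i j l} → i < l → j < l → rank i j < l * l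
rank-square {i} {j} {l} i<l j<l with ℕₚ.<-≤-connex i j
... | inj₁ i<j rewrite rank-< i<j = begin-strict
  j * j + i        <⟨ ℕₚ.+-monoʳ-< (j * j) i<j ⟩
  j * j + j        ≡⟨ ℕₚ.+-comm (j * j) j ⟩
  suc j * j        ≤⟨ ℕₚ.*-mono-≤ j<l (ℕₚ.<⇒≤ j<l) ⟩
  l * l            ∎
  where open ≤-Reasoning
... | inj₂ j≤i rewrite rank-≥ j≤i = begin-strict
  i * i + i + j    ≤⟨ ℕₚ.+-monoʳ-≤ (i * i + i) j≤i ⟩
  i * i + i + i    <⟨ ℕₚ.≤-reflexive (square i) ⟩
  suc i * suc i    ≤⟨ ℕₚ.*-mono-≤ i<l i<l ⟩
  l * l            ∎
  where
  open ≤-Reasoning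
  square : ∀ i → suc (i * i + i + i) ≡ suc i * suc i
  square = solve-∀

square-rankˡ : ∀ {i j l} → l ℕ.≤ i → l * l ℕ.≤ rank i j
square-rankˡ {i} {j} l≤i with ℕₚ.<-≤-connex i j
... | inj₁ i<j rewrite rank-< i<j =
  ℕₚ.≤-trans (ℕₚ.*-mono-≤ (ℕₚ.≤-trans l≤i (ℕₚ.<⇒≤ i<j)) (ℕₚ.≤-trans l≤i (ℕₚ.<⇒≤ i<j))) (ℕₚ.m≤m+n _ i)
... | inj₂ j≤i rewrite rank-≥ j≤i =
  ℕₚ.≤-trans (ℕₚ.*-mono-≤ l≤i l≤i) (ℕₚ.≤-trans (ℕₚ.m≤m+n _ i) (ℕₚ.m≤m+n _ j))

square-rankʳ : ∀ {i j l} → l ℕ.≤ j → l * l ℕ.≤ rank i j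
square-rankʳ {i} {j} l≤j with ℕₚ.<-≤-connex i j
... | inj₁ i<j rewrite rank-< i<j = ℕₚ.≤-trans (ℕₚ.*-mono-≤ l≤j l≤j) (ℕₚ.m≤m+n _ i)
... | inj₂ j≤i = square-rankˡ {j = j} (ℕₚ.≤-trans l≤j j≤i)

-- Going from `n` to `n + 1` adds a column with ranks from `n²` to `n² + n - 1` and a row with ranks
-- from `n² + n` to `n² + 2n`; these continue the interval of ranks without a gap.
count-rank : ∀ s n → Σ< n (λ i → Σ< n (λ j → ⟦ s ≤ᵇ rank i j ⟧)) ≡ n * n ∸ s
count-rank s zero    = sym (ℕₚ.0∸n≡0 s)
count-rank s (suc n) = begin
  Σ< n (λ i → Σ< n (R i) + R i n) + Σ< (suc n) (R n)
    ≡⟨ cong (_+ Σ< (suc n) (R n)) (Σ<-distrib-+ n (λ i → Σ< n (R i)) (λ i → R i n)) ⟩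
  Σ< n (λ i → Σ< n (R i)) + Σ< n (λ i → R i n) + Σ< (suc n) (R n)
    ≡⟨ cong₂ _+_ (cong₂ _+_ (count-rank s n) (Σ<-cong n column)) (Σ<-cong (suc n) row) ⟩
  (n * n ∸ s) + Σ< n (λ i → ⟦ s ≤ᵇ n * n + i ⟧) + Σ< (suc n) (λ j → ⟦ s ≤ᵇ n * n + n + j ⟧)
    ≡⟨ cong (_+ Σ< (suc n) (λ j → ⟦ s ≤ᵇ n * n + n + j ⟧)) (Σ<-≤ᵇ s (n * n) n) ⟩
  (n * n + n ∸ s) + Σ< (suc n) (λ j → ⟦ s ≤ᵇ n * n + n + j ⟧)
    ≡⟨ Σ<-≤ᵇ s (n * n + n) (suc n) ⟩
  (n * n + n + suc n) ∸ s
    ≡⟨ cong (_∸ s) (square n) ⟩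
  suc n * suc n ∸ s ∎
  where
  open ≡-Reasoning
  R : ℕ → ℕ → ℕ
  R i j = ⟦ s ≤ᵇ rank i j ⟧
  column : ∀ i → i < n → R i n ≡ ⟦ s ≤ᵇ n * n + i ⟧
  column i i<n = cong (λ r → ⟦ s ≤ᵇ r ⟧) (rank-< i<n)
  row : ∀ j → j < suc n → R n j ≡ ⟦ s ≤ᵇ n * n + n + j ⟧
  row j j<1+n = cong (λ r → ⟦ s ≤ᵇ r ⟧) (rank-≥ (ℕₚ.≤-pred j<1+n))
  square : ∀ n → n * n + n + suc n ≡ suc n * suc n
  square = solve-∀

-- The extremal hypergraphs

-- For s ≤ l² a pair of rank < s has both entries below l, so every triple with two entries ≥ l is
-- a member.
member : (l s x y z : ℕ) → Bool
member l s x y z =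
  ((l ≤ᵇ x) ∧ (s ≤ᵇ rank y z)) ∨ ((l ≤ᵇ y) ∧ (s ≤ᵇ rank z x)) ∨ ((l ≤ᵇ z) ∧ (s ≤ᵇ rank x y))

-- `rank` is not symmetric; the pairs in `member` are taken in cyclic order, so a rotation permutes
-- the three disjuncts.
member-cyc : ∀ l s x y z → member l s x y z ≡ member l s y z x
member-cyc l s x y z = trans (∨-comm p (q ∨ r)) (∨-assoc q r p)
  where
  p = (l ≤ᵇ x) ∧ (s ≤ᵇ rank y z)
  q = (l ≤ᵇ y) ∧ (s ≤ᵇ rank z x)
  r = (l ≤ᵇ z) ∧ (s ≤ᵇ rank x y)

⟦⟧≤1 : ∀ p → ⟦ p ⟧ ℕ.≤ 1
⟦⟧≤1 true  = ℕₚ.≤-refl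
⟦⟧≤1 false = z≤n

⟦∨⟧-mono : ∀ {p q r s} → ⟦ p ⟧ ℕ.≤ ⟦ q ⟧ → ⟦ r ⟧ ℕ.≤ ⟦ s ⟧ → ⟦ p ∨ r ⟧ ℕ.≤ ⟦ q ∨ s ⟧
⟦∨⟧-mono {true}  {true}      _ _   = ℕₚ.≤-refl
⟦∨⟧-mono {false} {true}  {r} _ _   = ⟦⟧≤1 r
⟦∨⟧-mono {false} {false}     _ r≤s = r≤s
⟦∨⟧-mono {true}  {false}     () _

⟦∧⟧-mono : ∀ {p q r s} → ⟦ p ⟧ ℕ.≤ ⟦ q ⟧ → ⟦ r ⟧ ℕ.≤ ⟦ s ⟧ → ⟦ p ∧ r ⟧ ℕ.≤ ⟦ q ∧ s ⟧
⟦∧⟧-mono {false}         _ _   = z≤n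
⟦∧⟧-mono {true} {true}   _ r≤s = r≤s
⟦∧⟧-mono {true} {false}  () _

⟦≤ᵇ⟧-anti : ∀ {s t} r → t ℕ.≤ s → ⟦ s ≤ᵇ r ⟧ ℕ.≤ ⟦ t ≤ᵇ r ⟧
⟦≤ᵇ⟧-anti {s} r t≤s with s ℕₚ.≤? r
... | yes s≤r rewrite ≤⇒≤ᵇ≡true (ℕₚ.≤-trans t≤s s≤r) = ⟦⟧≤1 (s ≤ᵇ r)
... | no  s≰r rewrite <⇒≤ᵇ≡false (ℕₚ.≰⇒> s≰r) = z≤n

member-anti : ∀ {l s l′ s′} → l′ ℕ.≤ l → s′ ℕ.≤ s → ∀ x y z →
              ⟦ member l s x y z ⟧ ℕ.≤ ⟦ member l′ s′ x y z ⟧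
member-anti {l} {s} {l′} {s′} l′≤l s′≤s x y z =
  ⟦∨⟧-mono (one x (rank y z)) (⟦∨⟧-mono (one y (rank z x)) (one z (rank x y)))
  where
  one : ∀ i r → ⟦ (l ≤ᵇ i) ∧ (s ≤ᵇ r) ⟧ ℕ.≤ ⟦ (l′ ≤ᵇ i) ∧ (s′ ≤ᵇ r) ⟧
  one i r = ⟦∧⟧-mono (⟦≤ᵇ⟧-anti i l′≤l) (⟦≤ᵇ⟧-anti r s′≤s)

layerDegree : (n l s x : ℕ) → ℕ
layerDegree n l s x = Σ< n λ y → Σ< n λ z → ⟦ member l s x y z ⟧

module _ {l s : ℕ} (s≤l² : s ℕ.≤ l * l) where

  private
    rankˡ : ∀ {i} j → (l ≤ᵇ i) ≡ true → (s ≤ᵇ rank i j) ≡ true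
    rankˡ {i} j l≤i = ≤⇒≤ᵇ≡true (ℕₚ.≤-trans s≤l²
      (square-rankˡ {i} {j} (ℕₚ.≤ᵇ⇒≤ l i (subst T (sym l≤i) _))))

    rankʳ : ∀ i {j} → (l ≤ᵇ j) ≡ true → (s ≤ᵇ rank i j) ≡ true
    rankʳ i {j} l≤j = ≤⇒≤ᵇ≡true (ℕₚ.≤-trans s≤l²
      (square-rankʳ {i} {j} (ℕₚ.≤ᵇ⇒≤ l j (subst T (sym l≤j) _))))

    <ᵇ≡not-≤ᵇ : ∀ i → (i <ᵇ l) ≡ not (l ≤ᵇ i)
    <ᵇ≡not-≤ᵇ i with i ℕₚ.<? l
    ... | yes i<l rewrite <⇒<ᵇ≡true i<l | <⇒≤ᵇ≡false i<l = refl
    ... | no  i≮l rewrite ≤⇒<ᵇ≡false (ℕₚ.≮⇒≥ i≮l) | ≤⇒≤ᵇ≡true (ℕₚ.≮⇒≥ i≮l) = refl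

  -- If `y` or `z` is also high, then `s ≤ l² ≤ rank y z` and both sides are true; otherwise every
  -- disjunct but the first fails.
  member-high : ∀ x y z → l ℕ.≤ x → member l s x y z ≡ (s ≤ᵇ rank y z)
  member-high x y z l≤x rewrite ≤⇒≤ᵇ≡true l≤x
    | rankʳ z (≤⇒≤ᵇ≡true l≤x) | rankˡ y (≤⇒≤ᵇ≡true l≤x)
    with l ≤ᵇ y in l≤y | l ≤ᵇ z in l≤z
  ... | true  | _     rewrite rankˡ z l≤y = refl
  ... | false | true  rewrite rankʳ y l≤z = refl
  ... | false | false = ∨-identityʳ _

  member-low : ∀ x y z → x < l → ⟦ member l s x y z ⟧ ≡
    ⟦ l ≤ᵇ y ⟧ * ⟦ l ≤ᵇ z ⟧ + ⟦ l ≤ᵇ y ⟧ * (⟦ z <ᵇ l ⟧ * ⟦ s ≤ᵇ rank z x ⟧)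
      + ⟦ y <ᵇ l ⟧ * (⟦ l ≤ᵇ z ⟧ * ⟦ s ≤ᵇ rank x y ⟧)
  member-low x y z x<l rewrite <⇒≤ᵇ≡false x<l | <ᵇ≡not-≤ᵇ y | <ᵇ≡not-≤ᵇ z
    with l ≤ᵇ y in l≤y | l ≤ᵇ z in l≤z
  ... | true  | true  rewrite rankˡ x l≤z = refl
  ... | true  | false rewrite ∨-identityʳ (s ≤ᵇ rank z x) = unit ⟦ s ≤ᵇ rank z x ⟧
    where
    unit : ∀ t → t ≡ t + 0 + 0 + 0
    unit = solve-∀
  ... | false | true  = unit ⟦ s ≤ᵇ rank x y ⟧
    where
    unit : ∀ t → t ≡ t + 0 + 0
    unit = solve-∀
  ... | false | false = refl

  layerDegree-high : ∀ n x → l ℕ.≤ x → layerDegree n l s x ≡ n * n ∸ s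
  layerDegree-high n x l≤x = trans
    (Σ<-cong n λ y _ → Σ<-cong n λ z _ → cong ⟦_⟧ (member-high x y z l≤x))
    (count-rank s n)

  -- With `a` high vertices per class, the edges at `x` have either two high vertices, or one high
  -- vertex and a pair of low vertices of rank at least `s` with `x` as second or first entry.
  layerDegree-low : ∀ a x → x < l → layerDegree (a + l) l s x ≡
    a * a + a * (Σ< l (λ z → ⟦ s ≤ᵇ rank z x ⟧) + Σ< l (λ y → ⟦ s ≤ᵇ rank x y ⟧))
  layerDegree-low a x x<l = begin
    layerDegree N l s x
      ≡⟨ Σ<-cong N (λ y _ → Σ<-cong N λ z _ → member-low x y z x<l) ⟩
    Σ< N (λ y → Σ< N λ z → A y * A z + A y * (B z * R z x) + B y * (A z * R x y))
      ≡⟨ Σ<-cong N (λ y _ → inner y) ⟩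
    Σ< N (λ y → A y * (a + r₁) + B y * (a * R x y))
      ≡⟨ Σ<-distrib-+ N (λ y → A y * (a + r₁)) (λ y → B y * (a * R x y)) ⟩
    Σ< N (λ y → A y * (a + r₁)) + Σ< N (λ y → B y * (a * R x y))
      ≡⟨ cong₂ _+_ (trans (*-distribʳ-Σ< N (a + r₁) A) (cong (_* (a + r₁)) ΣA))
                   (trans (Σ<-below a l (λ y → a * R x y)) (*-distribˡ-Σ< l a (R x))) ⟩
    a * (a + r₁) + a * r₂
      ≡⟨ rearranged a r₁ r₂ ⟩
    a * a + a * (r₁ + r₂) ∎
    where
    open ≡-Reasoning
    N = a + l
    A B : ℕ → ℕ
    A i = ⟦ l ≤ᵇ i ⟧
    B i = ⟦ i <ᵇ l ⟧
    R : ℕ → ℕ → ℕ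
    R i j = ⟦ s ≤ᵇ rank i j ⟧
    r₁ = Σ< l (λ z → R z x)
    r₂ = Σ< l (R x)
    ΣA : Σ< N A ≡ a
    ΣA = trans (trans (cong (_+ Σ< N A) (sym (ℕₚ.0∸n≡0 l))) (Σ<-≤ᵇ l 0 N)) (ℕₚ.m+n∸n≡m a l)
    rearranged : ∀ a r₁ r₂ → a * (a + r₁) + a * r₂ ≡ a * a + a * (r₁ + r₂)
    rearranged = solve-∀
    inner : ∀ y → Σ< N (λ z → A y * A z + A y * (B z * R z x) + B y * (A z * R x y))
                ≡ A y * (a + r₁) + B y * (a * R x y)
    inner y = begin
      Σ< N (λ z → A y * A z + A y * (B z * R z x) + B y * (A z * R x y))
        ≡⟨ Σ<-distrib-+ N (λ z → A y * A z + A y * (B z * R z x)) (λ z → B y * (A z * R x y)) ⟩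
      Σ< N (λ z → A y * A z + A y * (B z * R z x)) + Σ< N (λ z → B y * (A z * R x y))
        ≡⟨ cong₂ _+_ (Σ<-distrib-+ N (λ z → A y * A z) (λ z → A y * (B z * R z x)))
                     (*-distribˡ-Σ< N (B y) (λ z → A z * R x y)) ⟩
      Σ< N (λ z → A y * A z) + Σ< N (λ z → A y * (B z * R z x)) + B y * Σ< N (λ z → A z * R x y)
        ≡⟨ cong₂ _+_ (cong₂ _+_ (*-distribˡ-Σ< N (A y) A) (*-distribˡ-Σ< N (A y) (λ z → B z * R z x)))
                     (cong (B y *_) (*-distribʳ-Σ< N (R x y) A)) ⟩
      A y * Σ< N A + A y * Σ< N (λ z → B z * R z x) + B y * (Σ< N A * R x y)
        ≡⟨ cong₂ _+_ (cong₂ _+_ (cong (A y *_) ΣA) (cong (A y *_) (Σ<-below a l (λ z → R z x))))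
                     (cong (λ t → B y * (t * R x y)) ΣA) ⟩
      A y * a + A y * r₁ + B y * (a * R x y)
        ≡⟨ cong (_+ B y * (a * R x y)) (ℕₚ.*-distribˡ-+ (A y) a r₁) ⟨
      A y * (a + r₁) + B y * (a * R x y) ∎

  -- Summed over `x`, each of the two rank counts runs over all pairs below `l`, and `l² ∸ s` of
  -- these have rank at least `s`.
  lowTotal : ∀ a → Σ< l (layerDegree (a + l) l s) ≡ l * (a * a) + a * ((l * l ∸ s) + (l * l ∸ s))
  lowTotal a = begin
    Σ< l (layerDegree (a + l) l s)
      ≡⟨ Σ<-cong l (layerDegree-low a) ⟩
    Σ< l (λ x → a * a + a * (r₁ x + r₂ x))
      ≡⟨ Σ<-distrib-+ l (λ _ → a * a) (λ x → a * (r₁ x + r₂ x)) ⟩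
    Σ< l (λ _ → a * a) + Σ< l (λ x → a * (r₁ x + r₂ x))
      ≡⟨ cong₂ _+_ (Σ<-const l (a * a))
           (trans (*-distribˡ-Σ< l a (λ x → r₁ x + r₂ x)) (cong (a *_) (Σ<-distrib-+ l r₁ r₂))) ⟩
    l * (a * a) + a * (Σ< l r₁ + Σ< l r₂)
      ≡⟨ cong (λ t → l * (a * a) + a * t)
           (cong₂ _+_ (trans (Σ<-comm l l _) (count-rank s l)) (count-rank s l)) ⟩
    l * (a * a) + a * ((l * l ∸ s) + (l * l ∸ s)) ∎
    where
    open ≡-Reasoning
    r₁ r₂ : ℕ → ℕ
    r₁ x = Σ< l λ z → ⟦ s ≤ᵇ rank z x ⟧
    r₂ x = Σ< l λ y → ⟦ s ≤ᵇ rank x y ⟧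

  layerTotal : ∀ a → Σ< (a + l) (layerDegree (a + l) l s) ≡
    a * ((a + l) * (a + l) ∸ s) + (l * (a * a) + a * ((l * l ∸ s) + (l * l ∸ s)))
  layerTotal a = trans (above a) (cong (a * ((a + l) * (a + l) ∸ s) +_) (lowTotal a))
    where
    above : ∀ d → Σ< (d + l) (layerDegree (a + l) l s) ≡
            d * ((a + l) * (a + l) ∸ s) + Σ< l (layerDegree (a + l) l s)
    above zero    = refl
    above (suc d) = trans
      (cong₂ _+_ (above d) (layerDegree-high (a + l) (d + l) (ℕₚ.m≤n+m l d)))
      (trans (ℕₚ.+-comm _ c) (sym (ℕₚ.+-assoc c (d * c) _)))
      where c = (a + l) * (a + l) ∸ s

layer : (l s : ℕ) → Fin n → Fin n → Fin n → ℕ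
layer l s x y z = ⟦ member l s (toℕ x) (toℕ y) (toℕ z) ⟧

Σ₂-layer : ∀ l s (x : Fin n) → Σ₂ (layer l s x) ≡ layerDegree n l s (toℕ x)
Σ₂-layer {n} l s x = trans
  (sum-cong-≗ {n} λ y → sum≡Σ< n (λ z → ⟦ member l s (toℕ x) (toℕ y) z ⟧))
  (sum≡Σ< n (λ y → Σ< n λ z → ⟦ member l s (toℕ x) y z ⟧))

Σ₃-layer : ∀ n l s → Σ₃ {n} (layer l s) ≡ Σ< n (layerDegree n l s)
Σ₃-layer n l s = trans (sum-cong-≗ {n} (Σ₂-layer l s)) (sum≡Σ< n (layerDegree n l s))

Σ<-below-≤ : ∀ {b n} → b ℕ.≤ n → (f : ℕ → ℕ) → Σ< n (λ i → ⟦ i <ᵇ b ⟧ * f i) ≡ Σ< b f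
Σ<-below-≤ {b} {n} b≤n f =
  subst (λ k → Σ< k (λ i → ⟦ i <ᵇ b ⟧ * f i) ≡ Σ< b f) (ℕₚ.m∸n+n≡m b≤n) (Σ<-below (n ∸ b) b f)

sum-below : ∀ {b} → b ℕ.≤ n → (f : ℕ → ℕ) → sum {n} (λ x → ⟦ toℕ x <ᵇ b ⟧ * f (toℕ x)) ≡ Σ< b f
sum-below {n} {b} b≤n f = trans (sum≡Σ< n (λ i → ⟦ i <ᵇ b ⟧ * f i)) (Σ<-below-≤ b≤n f)

-- In the inner layer the vertices above `b` are high, with degree `n² - s ≥ n² - m`. The outer
-- layer only has to be bounded on the vertices below `b`.
layer-sandwich : ∀ {n m S b l′ s s′} → b < n → s ℕ.≤ suc b * suc b → s ℕ.≤ m → l′ ℕ.≤ suc b → s′ ℕ.≤ s →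
  Σ< b (layerDegree n l′ s′) ℕ.≤ b * m →
  Σ< n (layerDegree n (suc b) s) ℕ.≤ S → S ℕ.≤ Σ< n (layerDegree n l′ s′) →
  {D₁ D₂ D₃ : Fin n → ℕ} →
  Target m (n * n ∸ m) S D₁ → Target m (n * n ∸ m) S D₂ → Target m (n * n ∸ m) S D₃ →
  Realization D₁ D₂ D₃
layer-sandwich {n} {m} {S} {b} {l′} {s} {s′} b<n s≤l² s≤m l′≤l s′≤s low≤ A≤S S≤B =
  sandwich {b = b} (layer (suc b) s) (layer l′ s′)
    (λ x y z → member-anti l′≤l s′≤s (toℕ x) (toℕ y) (toℕ z))
    (λ x y z → ⟦⟧≤1 _)
    (λ x y z → cong ⟦_⟧ (member-cyc (suc b) s (toℕ x) (toℕ y) (toℕ z)))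
    (λ x y z → cong ⟦_⟧ (member-cyc l′ s′ (toℕ x) (toℕ y) (toℕ z)))
    (subst (ℕ._≤ S) (sym (Σ₃-layer n (suc b) s)) A≤S)
    (subst (S ℕ.≤_) (sym (Σ₃-layer n l′ s′)) S≤B)
    (sum-mono-≤ {n} high)
    low
  where
  high : ∀ x → ⟦ b <ᵇ toℕ x ⟧ * (n * n ∸ m) ℕ.≤ ⟦ b <ᵇ toℕ x ⟧ * Σ₂ (layer (suc b) s x)
  high x with b ℕₚ.<? toℕ x
  ... | no  b≮x rewrite ≤⇒<ᵇ≡false (ℕₚ.≮⇒≥ b≮x) = z≤n
  ... | yes b<x = ℕₚ.*-monoʳ-≤ ⟦ b <ᵇ toℕ x ⟧ (begin
    n * n ∸ m                            ≤⟨ ℕₚ.∸-monoʳ-≤ (n * n) s≤m ⟩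
    n * n ∸ s                            ≡⟨ layerDegree-high s≤l² n (toℕ x) b<x ⟨
    layerDegree n (suc b) s (toℕ x)      ≡⟨ Σ₂-layer (suc b) s x ⟨
    Σ₂ (layer (suc b) s x)               ∎)
    where open ≤-Reasoning
  low : sum {n} (λ x → ⟦ toℕ x <ᵇ b ⟧ * Σ₂ (layer l′ s′ x)) ℕ.≤ sum {n} (λ x → ⟦ toℕ x <ᵇ b ⟧ * m)
  low = begin
    sum {n} (λ x → ⟦ toℕ x <ᵇ b ⟧ * Σ₂ (layer l′ s′ x))
      ≡⟨ sum-cong-≗ {n} (λ x → cong (⟦ toℕ x <ᵇ b ⟧ *_) (Σ₂-layer l′ s′ x)) ⟩
    sum {n} (λ x → ⟦ toℕ x <ᵇ b ⟧ * layerDegree n l′ s′ (toℕ x))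
      ≡⟨ sum-below (ℕₚ.<⇒≤ b<n) (layerDegree n l′ s′) ⟩
    Σ< b (layerDegree n l′ s′)
      ≤⟨ low≤ ⟩
    b * m
      ≡⟨ Σ<-const b m ⟨
    Σ< b (λ _ → m)
      ≡⟨ sum-below (ℕₚ.<⇒≤ b<n) (λ _ → m) ⟨
    sum {n} (λ x → ⟦ toℕ x <ᵇ b ⟧ * m) ∎
    where open ≤-Reasoning

-- The bound on low degrees and the chain of layers

2xy≤x²+y² : ∀ x y → 2 * (x * y) ℕ.≤ x * x + y * y
2xy≤x²+y² x y with ℕₚ.≤-total x y
... | inj₁ x≤y = subst (λ y → 2 * (x * y) ℕ.≤ x * x + y * y) (ℕₚ.m+[n∸m]≡n x≤y) (ordered x (y ∸ x))
  where
  ordered : ∀ x d → 2 * (x * (x + d)) ℕ.≤ x * x + (x + d) * (x + d)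
  ordered x d = subst (2 * (x * (x + d)) ℕ.≤_) (expand x d) (ℕₚ.m≤m+n _ (d * d))
    where
    expand : ∀ x d → 2 * (x * (x + d)) + d * d ≡ x * x + (x + d) * (x + d)
    expand = solve-∀
... | inj₂ y≤x = subst (λ x → 2 * (x * y) ℕ.≤ x * x + y * y) (ℕₚ.m+[n∸m]≡n y≤x) (ordered y (x ∸ y))
  where
  ordered : ∀ y d → 2 * ((y + d) * y) ℕ.≤ (y + d) * (y + d) + y * y
  ordered y d = subst (2 * ((y + d) * y) ℕ.≤_) (expand y d) (ℕₚ.m≤m+n _ (d * d))
    where
    expand : ∀ y d → 2 * ((y + d) * y) + d * d ≡ (y + d) * (y + d) + y * y
    expand = solve-∀

-- The difference of the two sides is (2a − l)² (4a + 7l) + l³.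
two-sevenths : ∀ a l → 28 * (a * l * (a + 2 * l)) ℕ.≤ 8 * ((a + l) * (a + l) * (l + 2 * a))
two-sevenths a l = ℕₚ.+-cancelʳ-≤ (2 * (2 * a * l) * (4 * a + 7 * l)) _ _ (begin
  28 * (a * l * (a + 2 * l)) + 2 * (2 * a * l) * (4 * a + 7 * l)
    ≤⟨ ℕₚ.+-monoʳ-≤ (28 * (a * l * (a + 2 * l))) (ℕₚ.*-monoˡ-≤ (4 * a + 7 * l) (2xy≤x²+y² (2 * a) l)) ⟩
  28 * (a * l * (a + 2 * l)) + (2 * a * (2 * a) + l * l) * (4 * a + 7 * l)
    ≤⟨ ℕₚ.m≤m+n _ (l * l * l) ⟩
  28 * (a * l * (a + 2 * l)) + (2 * a * (2 * a) + l * l) * (4 * a + 7 * l) + l * l * l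
    ≡⟨ expand a l ⟩
  8 * ((a + l) * (a + l) * (l + 2 * a)) + 2 * (2 * a * l) * (4 * a + 7 * l) ∎)
  where
  open ≤-Reasoning
  expand : ∀ a l → 28 * (a * l * (a + 2 * l)) + (2 * a * (2 * a) + l * l) * (4 * a + 7 * l) + l * l * l
                 ≡ 8 * ((a + l) * (a + l) * (l + 2 * a)) + 2 * (2 * a * l) * (4 * a + 7 * l)
  expand = solve-∀

-- If `l² ≤ m`, every edge has two high vertices and `a² ≤ l² ≤ m` suffices. Otherwise adding `2am`
-- removes the subtractions, and `two-sevenths` combined with `2n² ≤ 7m` gives the rest.
lowTotal-bound : ∀ a l m → a ℕ.≤ l → 2 * ((a + l) * (a + l)) ℕ.≤ 7 * m →
  l * (a * a) + a * ((l * l ∸ m ⊓ (l * l)) + (l * l ∸ m ⊓ (l * l))) ℕ.≤ l * m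
lowTotal-bound a l m a≤l 2n²≤7m with ℕₚ.≤-total m (l * l)
... | inj₂ l²≤m rewrite ℕₚ.m≥n⇒m⊓n≡n l²≤m | ℕₚ.n∸n≡0 (l * l) | ℕₚ.*-zeroʳ a | ℕₚ.+-identityʳ (l * (a * a)) =
  ℕₚ.*-monoʳ-≤ l (ℕₚ.≤-trans (ℕₚ.*-mono-≤ a≤l a≤l) l²≤m)
... | inj₁ m≤l² rewrite ℕₚ.m≤n⇒m⊓n≡m m≤l² = ℕₚ.+-cancelʳ-≤ (2 * (a * m)) _ _ (begin
  l * (a * a) + a * (t + t) + 2 * (a * m)      ≡⟨ collect a l t m ⟩
  l * (a * a) + 2 * (a * (t + m))              ≡⟨ cong (λ q → l * (a * a) + 2 * (a * q)) (ℕₚ.m∸n+n≡m m≤l²) ⟩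
  l * (a * a) + 2 * (a * (l * l))              ≤⟨ ℕₚ.*-cancelˡ-≤ 28 scaled ⟩
  l * m + 2 * (a * m)                          ∎)
  where
  open ≤-Reasoning
  t = l * l ∸ m
  collect : ∀ a l t m → l * (a * a) + a * (t + t) + 2 * (a * m) ≡ l * (a * a) + 2 * (a * (t + m))
  collect = solve-∀
  scaled : 28 * (l * (a * a) + 2 * (a * (l * l))) ℕ.≤ 28 * (l * m + 2 * (a * m))
  scaled = begin
    28 * (l * (a * a) + 2 * (a * (l * l)))       ≡⟨ left a l ⟩
    28 * (a * l * (a + 2 * l))                   ≤⟨ two-sevenths a l ⟩
    8 * ((a + l) * (a + l) * (l + 2 * a))        ≡⟨ middle a l ⟩
    4 * (l + 2 * a) * (2 * ((a + l) * (a + l)))  ≤⟨ ℕₚ.*-monoʳ-≤ (4 * (l + 2 * a)) 2n²≤7m ⟩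
    4 * (l + 2 * a) * (7 * m)                    ≡⟨ right a l m ⟩
    28 * (l * m + 2 * (a * m))                   ∎
    where
    left : ∀ a l → 28 * (l * (a * a) + 2 * (a * (l * l))) ≡ 28 * (a * l * (a + 2 * l))
    left = solve-∀
    middle : ∀ a l → 8 * ((a + l) * (a + l) * (l + 2 * a)) ≡ 4 * (l + 2 * a) * (2 * ((a + l) * (a + l)))
    middle = solve-∀
    right : ∀ a l m → 4 * (l + 2 * a) * (7 * m) ≡ 28 * (l * m + 2 * (a * m))
    right = solve-∀

module Chain {n m S : ℕ} (2n²≤7m : 2 * (n * n) ℕ.≤ 7 * m) {D₁ D₂ D₃ : Fin n → ℕ}
  (tgt₁ : Target m (n * n ∸ m) S D₁) (tgt₂ : Target m (n * n ∸ m) S D₂)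
  (tgt₃ : Target m (n * n ∸ m) S D₃) where

  -- There are only `l²` pairs below `l`; the cap secures the condition `s ≤ l²` of the degree
  -- formulas.
  threshold : ℕ → ℕ
  threshold l = m ⊓ (l * l)

  size : ℕ → ℕ
  size l = Σ< n (layerDegree n l (threshold l))

  size-n : size n ≡ 0
  size-n = trans (layerTotal {n} (ℕₚ.m⊓n≤n m (n * n)) 0) (trans (ℕₚ.+-identityʳ (n * 0)) (ℕₚ.*-zeroʳ n))

  low-bound : ∀ a l → a + l ≡ n → a ℕ.≤ l → Σ< l (layerDegree n l (threshold l)) ℕ.≤ l * m
  low-bound a l refl a≤l = ℕₚ.≤-trans
    (ℕₚ.≤-reflexive (lowTotal {l} (ℕₚ.m⊓n≤n m (l * l)) a)) (lowTotal-bound a l m a≤l 2n²≤7m)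

  module _ {k l′ s′ : ℕ} (n≤2l : n ℕ.≤ suc k + suc k) (k<n : k < n)
    (l′≤l : l′ ℕ.≤ suc k) (s′≤s : s′ ℕ.≤ threshold (suc k))
    (low≤ : Σ< k (layerDegree n l′ s′) ℕ.≤ k * m) (S≤ : S ℕ.≤ Σ< n (layerDegree n l′ s′)) where

    -- Lowers `l` while the layer has at most `S` edges. The first layer with at least `S` edges and
    -- its predecessor enclose the required hypergraph; below `l = k + 1` the closing layer given by
    -- `l′` and `s′` takes over. Since `n ≤ 2(k + 1)`, there are never more high than low vertices,
    -- as `low-bound` requires.
    descend : ∀ j → j + suc k ℕ.≤ n → size (j + suc k) ℕ.≤ S → Realization D₁ D₂ D₃
    descend zero    _   ≤S = layer-sandwich k<n (ℕₚ.m⊓n≤n m _) (ℕₚ.m⊓n≤m m _) l′≤l s′≤s low≤ ≤S S≤ tgt₁ tgt₂ tgt₃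
    descend (suc j) l≤n ≤S with ℕₚ.≤-total (size (j + suc k)) S
    ... | inj₁ size≤S = descend j (ℕₚ.≤-trans (ℕₚ.n≤1+n _) l≤n) size≤S
    ... | inj₂ S≤size = layer-sandwich l≤n (ℕₚ.m⊓n≤n m _) (ℕₚ.m⊓n≤m m _) (ℕₚ.n≤1+n l)
        (ℕₚ.⊓-monoʳ-≤ m (ℕₚ.*-mono-≤ (ℕₚ.n≤1+n l) (ℕₚ.n≤1+n l)))
        (low-bound (n ∸ l) l (ℕₚ.m∸n+n≡m (ℕₚ.<⇒≤ l≤n)) a≤l) ≤S S≤size tgt₁ tgt₂ tgt₃
      where
      l = j + suc k
      a≤l : n ∸ l ℕ.≤ l
      a≤l = ℕₚ.m≤n+o⇒m∸n≤o n l (ℕₚ.≤-trans n≤2l (ℕₚ.+-mono-≤ (ℕₚ.m≤n+m (suc k) j) (ℕₚ.m≤n+m (suc k) j)))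

    chain : Realization D₁ D₂ D₃
    chain = descend (n ∸ suc k) (ℕₚ.≤-reflexive eq)
      (subst (λ l → size l ℕ.≤ S) (sym eq) (subst (ℕ._≤ S) (sym size-n) z≤n))
      where
      eq : n ∸ suc k + suc k ≡ n
      eq = ℕₚ.m∸n+n≡m k<n

parity : ∀ n → ∃[ k ] (n ≡ k + k ⊎ n ≡ k + suc k)
parity zero = 0 , inj₁ refl
parity (suc n) with parity n
... | k , inj₁ refl = k , inj₂ (sym (ℕₚ.+-suc k k))
... | k , inj₂ refl = suc k , inj₁ refl

-- The chain of layers ends with layer k k² for n = 2k and with layer (k + 1) (k² + k) for n = 2k + 1;
-- both have ⌊n³/2⌋ hyperedges.
lower-half : ∀ {n m S} → 0 < n → 2 * (n * n) ℕ.≤ 7 * m → S + S ℕ.≤ n * (n * n) →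
  {D₁ D₂ D₃ : Fin n → ℕ} →
  Target m (n * n ∸ m) S D₁ → Target m (n * n ∸ m) S D₂ → Target m (n * n ∸ m) S D₃ →
  Realization D₁ D₂ D₃
lower-half {n} {m} {S} 0<n 2n²≤7m 2S≤n³ tgt₁ tgt₂ tgt₃ with parity n
... | zero , inj₁ refl = contradiction 0<n λ ()
... | k@(suc k-1) , inj₁ refl = chain
    (ℕₚ.+-mono-≤ (ℕₚ.n≤1+n k) (ℕₚ.n≤1+n k)) (ℕₚ.m<n+m k (s≤s z≤n)) (ℕₚ.n≤1+n k)
    (ℕₚ.⊓-glb k²≤m (ℕₚ.*-mono-≤ (ℕₚ.n≤1+n k) (ℕₚ.n≤1+n k)))
    low S≤
  where
  open Chain 2n²≤7m tgt₁ tgt₂ tgt₃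
  open ≤-Reasoning
  k²≤m : k * k ℕ.≤ m
  k²≤m = ℕₚ.*-cancelˡ-≤ 7 (begin
    7 * (k * k)              ≤⟨ ℕₚ.m≤n+m _ (k * k) ⟩
    k * k + 7 * (k * k)      ≡⟨ eight k ⟩
    2 * ((k + k) * (k + k))  ≤⟨ 2n²≤7m ⟩
    7 * m                    ∎)
    where
    eight : ∀ k → k * k + 7 * (k * k) ≡ 2 * ((k + k) * (k + k))
    eight = solve-∀
  -- With `s = k²` no pair below `k` is left, so a low vertex lies only in the `k²` edges with two
  -- high vertices.
  low : Σ< k (layerDegree (k + k) k (k * k)) ℕ.≤ k * m
  low = begin
    Σ< k (layerDegree (k + k) k (k * k))
      ≡⟨ lowTotal {k} {k * k} ℕₚ.≤-refl k ⟩
    k * (k * k) + k * ((k * k ∸ k * k) + (k * k ∸ k * k))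
      ≡⟨ cong (λ t → k * (k * k) + k * (t + t)) (ℕₚ.n∸n≡0 (k * k)) ⟩
    k * (k * k) + k * 0
      ≡⟨ trans (cong (k * (k * k) +_) (ℕₚ.*-zeroʳ k)) (ℕₚ.+-identityʳ _) ⟩
    k * (k * k)
      ≤⟨ ℕₚ.*-monoʳ-≤ k k²≤m ⟩
    k * m ∎
  S≤ : S ℕ.≤ Σ< (k + k) (layerDegree (k + k) k (k * k))
  S≤ = ℕₚ.*-cancelˡ-≤ 2 (begin
    2 * S                                  ≡⟨ cong (S +_) (ℕₚ.+-identityʳ S) ⟩
    S + S                                  ≤⟨ 2S≤n³ ⟩
    (k + k) * ((k + k) * (k + k))          ≡⟨ cube k ⟩
    2 * (k * (3 * (k * k)) + (k * (k * k) + k * (0 + 0)))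
      ≡⟨ cong₂ (λ t u → 2 * (k * t + (k * (k * k) + k * (u + u)))) (sym rest) (sym (ℕₚ.n∸n≡0 (k * k))) ⟩
    2 * (k * ((k + k) * (k + k) ∸ k * k) + (k * (k * k) + k * ((k * k ∸ k * k) + (k * k ∸ k * k))))
      ≡⟨ cong (2 *_) (layerTotal {k} {k * k} ℕₚ.≤-refl k) ⟨
    2 * Σ< (k + k) (layerDegree (k + k) k (k * k)) ∎)
    where
    cube : ∀ k → (k + k) * ((k + k) * (k + k)) ≡ 2 * (k * (3 * (k * k)) + (k * (k * k) + k * (0 + 0)))
    cube = solve-∀
    square : ∀ k → (k + k) * (k + k) ≡ 3 * (k * k) + k * k
    square = solve-∀
    rest : (k + k) * (k + k) ∸ k * k ≡ 3 * (k * k)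
    rest = trans (cong (_∸ k * k) (square k)) (ℕₚ.m+n∸n≡m (3 * (k * k)) (k * k))
... | k , inj₂ refl = chain
    (ℕₚ.+-monoˡ-≤ (suc k) (ℕₚ.n≤1+n k)) (ℕₚ.m≤n+m (suc k) k) ℕₚ.≤-refl
    (ℕₚ.⊓-glb s≤m s≤l²) low S≤
  where
  open Chain 2n²≤7m tgt₁ tgt₂ tgt₃
  open ≤-Reasoning
  l = suc k
  s = k * k + k
  s≤m : s ℕ.≤ m
  s≤m = ℕₚ.*-cancelˡ-≤ 7 (begin
    7 * (k * k + k)                      ≤⟨ ℕₚ.m≤n+m _ (k * k + k + 2) ⟩
    k * k + k + 2 + 7 * (k * k + k)      ≡⟨ eight k ⟩
    2 * ((k + suc k) * (k + suc k))      ≤⟨ 2n²≤7m ⟩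
    7 * m                                ∎)
    where
    eight : ∀ k → k * k + k + 2 + 7 * (k * k + k) ≡ 2 * ((k + suc k) * (k + suc k))
    eight = solve-∀
  l²≡ : ∀ k → suc k * suc k ≡ suc k + (k * k + k)
  l²≡ = solve-∀
  s≤l² : s ℕ.≤ l * l
  s≤l² = subst (s ℕ.≤_) (sym (l²≡ k)) (ℕₚ.m≤n+m s l)
  -- A vertex x < k meets, besides the k² edges with two vertices above k, only k edges through
  -- the middle vertex k of one class: rank k x ≥ s > rank x k.
  vertex : ∀ x → x < k → layerDegree (k + l) l s x ℕ.≤ m
  vertex x x<k = begin
    layerDegree (k + l) l s x
      ≡⟨ layerDegree-low s≤l² k x (ℕₚ.m<n⇒m<1+n x<k) ⟩
    k * k + k * ((Σ< k (λ z → ⟦ s ≤ᵇ rank z x ⟧) + ⟦ s ≤ᵇ rank k x ⟧)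
               + (Σ< k (λ y → ⟦ s ≤ᵇ rank x y ⟧) + ⟦ s ≤ᵇ rank x k ⟧))
      ≤⟨ ℕₚ.+-monoʳ-≤ (k * k) (ℕₚ.*-monoʳ-≤ k (ℕₚ.+-mono-≤
           (ℕₚ.+-mono-≤ (none λ z z<k → small z<k x<k) (⟦⟧≤1 (s ≤ᵇ rank k x)))
           (ℕₚ.+-mono-≤ (none λ y y<k → small x<k y<k)
             (ℕₚ.≤-reflexive (cong ⟦_⟧ (<⇒≤ᵇ≡false rank-x-k)))))) ⟩
    k * k + k * ((0 + 1) + (0 + 0))
      ≡⟨ cong (k * k +_) (ℕₚ.*-identityʳ k) ⟩
    s
      ≤⟨ s≤m ⟩
    m ∎
    where
    small : ∀ {i j} → i < k → j < k → rank i j < s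
    small i<k j<k = ℕₚ.<-≤-trans (rank-square i<k j<k) (ℕₚ.m≤m+n (k * k) k)
    rank-x-k : rank x k < s
    rank-x-k = subst (_< s) (sym (rank-< x<k)) (ℕₚ.+-monoʳ-< (k * k) x<k)
    none : {r : ℕ → ℕ} → (∀ i → i < k → r i < s) → Σ< k (λ i → ⟦ s ≤ᵇ r i ⟧) ℕ.≤ 0
    none r<s = ℕₚ.≤-reflexive (trans (Σ<-cong k λ i i<k → cong ⟦_⟧ (<⇒≤ᵇ≡false (r<s i i<k)))
                                     (trans (Σ<-const k 0) (ℕₚ.*-zeroʳ k)))
  -- The middle vertex `k` is low in this layer, but it is the vertex between the blocks and is not
  -- counted.
  low : Σ< k (layerDegree (k + l) l s) ℕ.≤ k * m
  low = ℕₚ.≤-trans (Σ<-mono-≤ k vertex) (ℕₚ.≤-reflexive (Σ<-const k m))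
  S≤ : S ℕ.≤ Σ< (k + l) (layerDegree (k + l) l s)
  -- Here `n³` is odd, namely twice the size of the layer plus one; hence the strict comparison with
  -- the successor of the size.
  S≤ = ℕₚ.≤-pred (ℕₚ.*-cancelˡ-< 2 S _ (begin-strict
    2 * S                                  ≡⟨ cong (S +_) (ℕₚ.+-identityʳ S) ⟩
    S + S                                  ≤⟨ 2S≤n³ ⟩
    (k + l) * ((k + l) * (k + l))          <⟨ ℕₚ.≤-reflexive (cube k) ⟩
    2 * suc (k * (3 * (k * k) + 3 * k + 1) + (l * (k * k) + k * (l + l)))
      ≡⟨ cong₂ (λ t u → 2 * suc (k * t + (l * (k * k) + k * (u + u)))) (sym rest₁) (sym rest₂) ⟩
    2 * suc (k * ((k + l) * (k + l) ∸ s) + (l * (k * k) + k * ((l * l ∸ s) + (l * l ∸ s))))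
      ≡⟨ cong (λ t → 2 * suc t) (layerTotal s≤l² k) ⟨
    2 * suc (Σ< (k + l) (layerDegree (k + l) l s)) ∎))
    where
    cube : ∀ k → suc ((k + suc k) * ((k + suc k) * (k + suc k))) ≡
      2 * suc (k * (3 * (k * k) + 3 * k + 1) + (suc k * (k * k) + k * (suc k + suc k)))
    cube = solve-∀
    square : ∀ k → (k + suc k) * (k + suc k) ≡ 3 * (k * k) + 3 * k + 1 + (k * k + k)
    square = solve-∀
    rest₁ : (k + l) * (k + l) ∸ s ≡ 3 * (k * k) + 3 * k + 1
    rest₁ = trans (cong (_∸ s) (square k)) (ℕₚ.m+n∸n≡m (3 * (k * k) + 3 * k + 1) s)
    rest₂ : l * l ∸ s ≡ l
    rest₂ = trans (cong (_∸ s) (l²≡ k)) (ℕₚ.m+n∸n≡m l s)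

-- Sorting and complementation

argmin : (D : Fin (suc n) → ℕ) → ∃[ i ] (∀ j → D i ℕ.≤ D j)
argmin {zero}  D = zero , λ { zero → ℕₚ.≤-refl }
argmin {suc n} D with argmin (D ∘ suc)
... | i , Di≤ with ℕₚ.≤-total (D zero) (D (suc i))
...   | inj₁ D0≤Di = zero , λ { zero → ℕₚ.≤-refl ; (suc j) → ℕₚ.≤-trans D0≤Di (Di≤ j) }
...   | inj₂ Di≤D0 = suc i , λ { zero → Di≤D0 ; (suc j) → Di≤ j }

-- Selection sort: a transposition brings a minimum to the front, and the remaining entries are
-- sorted recursively.
sorting : (D : Fin n → ℕ) →
          Σ[ π ∈ Permutation n n ] (∀ i j → toℕ i ℕ.≤ toℕ j → D (π ⟨$⟩ʳ i) ℕ.≤ D (π ⟨$⟩ʳ j))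
sorting {zero}  D = Perm.id , λ ()
sorting {suc n} D with argmin D
... | i₀ , Di₀≤ with sorting (λ i → D (Perm.transpose zero i₀ ⟨$⟩ʳ suc i))
...   | π , asc = Perm.lift₀ π ∘ₚ Perm.transpose zero i₀ , λ where
  zero    j       _         → Di₀≤ _
  (suc i) (suc j) (s≤s i≤j) → asc i j i≤j

permute₁ : {d₁ d₂ d₃ : Fin n → ℕ} (π : Permutation n n) →
           Realization (λ i → d₁ (π ⟨$⟩ʳ i)) d₂ d₃ → Realization d₁ d₂ d₃
permute₁ {d₁ = d₁} π R = record
  { edge   = λ x → edge R (π ⟨$⟩ˡ x)
  ; edge≤1 = λ x → edge≤1 R (π ⟨$⟩ˡ x)
  ; deg₁   = λ x → trans (deg₁ R (π ⟨$⟩ˡ x)) (cong d₁ (Perm.inverseʳ π))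
  ; deg₂   = λ y → trans (sum-cong-≗ λ z → sym (sum-permute (λ x → edge R x y z) (Perm.flip π))) (deg₂ R y)
  ; deg₃   = λ z → trans (sym (sum-permute (λ x → sum λ y → edge R x y z) (Perm.flip π))) (deg₃ R z)
  }

sum-const : ∀ n c → sum {n} (λ _ → c) ≡ n * c
sum-const n c = trans (sum≡Σ< n (λ _ → c)) (Σ<-const n c)

Σ₂-complement : (e : Fin n → Fin n → ℕ) → (∀ i j → e i j ℕ.≤ 1) → ∀ {d} → d ℕ.≤ n * n →
                Σ₂ e ≡ n * n ∸ d → Σ₂ (λ i j → 1 ∸ e i j) ≡ d
Σ₂-complement {n} e e≤1 {d} d≤n² ∑e = ℕₚ.+-cancelʳ-≡ (Σ₂ e) _ _ (begin
  Σ₂ (λ i j → 1 ∸ e i j) + Σ₂ e        ≡⟨ Σ₂-distrib-+ (λ i j → 1 ∸ e i j) e ⟨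
  Σ₂ (λ i j → 1 ∸ e i j + e i j)       ≡⟨ Σ₂-cong (λ i j → ℕₚ.m∸n+n≡m (e≤1 i j)) ⟩
  Σ₂ {n} (λ _ _ → 1)                   ≡⟨ trans (sum-const n _) (cong (n *_) (trans (sum-const n 1) (ℕₚ.*-identityʳ n))) ⟩
  n * n                                ≡⟨ ℕₚ.m+[n∸m]≡n d≤n² ⟨
  d + (n * n ∸ d)                      ≡⟨ cong (λ t → d + t) ∑e ⟨
  d + Σ₂ e                             ∎)
  where open ≡-Reasoning

complement : {d₁ d₂ d₃ : Fin n → ℕ} →
  (∀ i → d₁ i ℕ.≤ n * n) → (∀ i → d₂ i ℕ.≤ n * n) → (∀ i → d₃ i ℕ.≤ n * n) →
  Realization (λ i → n * n ∸ d₁ i) (λ i → n * n ∸ d₂ i) (λ i → n * n ∸ d₃ i) → Realization d₁ d₂ d₃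
complement d₁≤ d₂≤ d₃≤ R = record
  { edge   = λ x y z → 1 ∸ edge R x y z
  ; edge≤1 = λ x y z → ℕₚ.m∸n≤m 1 (edge R x y z)
  ; deg₁   = λ x → Σ₂-complement _ (λ y z → edge≤1 R x y z) (d₁≤ x) (deg₁ R x)
  ; deg₂   = λ y → Σ₂-complement _ (λ z x → edge≤1 R x y z) (d₂≤ y) (deg₂ R y)
  ; deg₃   = λ z → Σ₂-complement _ (λ x y → edge≤1 R x y z) (d₃≤ z) (deg₃ R z)
  }

-- The upper bound is stated as an addition: under `d ↦ n² - d` it exchanges with the lower bound,
-- so the same `m` serves for the complement.
record Admissible (m S : ℕ) (D : Fin n → ℕ) : Set where
  field
    lower  : ∀ i → m ℕ.≤ D i
    upper  : ∀ i → D i + m ℕ.≤ n * n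
    total  : sum D ≡ S

module _ {n m S : ℕ} {D : Fin n → ℕ} (adm : Admissible m S D) where
  open Admissible adm renaming (lower to m≤D; upper to D+m≤n²; total to ∑D)

  admissible-≤ : ∀ i → D i ℕ.≤ n * n
  admissible-≤ i = ℕₚ.≤-trans (ℕₚ.m≤m+n (D i) m) (D+m≤n² i)

  sorted-target : let π = proj₁ (sorting D) in Target m (n * n ∸ m) S (λ i → D (π ⟨$⟩ʳ i))
  sorted-target = record
    { ascending = proj₂ (sorting D)
    ; lower     = λ i → m≤D _
    ; upper     = λ i → ℕₚ.m+n≤o⇒m≤o∸n _ (D+m≤n² _)
    ; total     = trans (sym (sum-permute D (proj₁ (sorting D)))) ∑D
    }

  sum-complement : sum (λ i → n * n ∸ D i) + S ≡ n * (n * n)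
  sum-complement = begin
    sum (λ i → n * n ∸ D i) + S        ≡⟨ cong (λ t → sum (λ i → n * n ∸ D i) + t) ∑D ⟨
    sum (λ i → n * n ∸ D i) + sum D    ≡⟨ ∑-distrib-+ (λ i → n * n ∸ D i) D ⟨
    sum (λ i → n * n ∸ D i + D i)      ≡⟨ sum-cong-≗ (λ i → ℕₚ.m∸n+n≡m (admissible-≤ i)) ⟩
    sum {n} (λ _ → n * n)              ≡⟨ sum-const n (n * n) ⟩
    n * (n * n)                        ∎
    where open ≡-Reasoning

  complement-admissible : Admissible m (n * (n * n) ∸ S) (λ i → n * n ∸ D i)
  complement-admissible = record
    { lower = λ i → ℕₚ.m+n≤o⇒m≤o∸n m (subst (ℕ._≤ n * n) (ℕₚ.+-comm (D i) m) (D+m≤n² i))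
    ; upper = λ i → ℕₚ.≤-trans (ℕₚ.+-monoʳ-≤ (n * n ∸ D i) (m≤D i)) (ℕₚ.≤-reflexive (ℕₚ.m∸n+n≡m (admissible-≤ i)))
    ; total = trans (sym (ℕₚ.m+n∸n≡m (sum λ i → n * n ∸ D i) S)) (cong (_∸ S) sum-complement)
    }

realize-half : ∀ {n m S} → 0 < n → 2 * (n * n) ℕ.≤ 7 * m → S + S ℕ.≤ n * (n * n) →
  {D₁ D₂ D₃ : Fin n → ℕ} →
  Admissible m S D₁ → Admissible m S D₂ → Admissible m S D₃ → Realization D₁ D₂ D₃
realize-half 0<n 2n²≤7m 2S≤n³ {D₁} {D₂} {D₃} adm₁ adm₂ adm₃ =
  rotate (permute₁ (proj₁ (sorting D₃)) (rotate (permute₁ (proj₁ (sorting D₂))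
    (rotate (permute₁ (proj₁ (sorting D₁)) (lower-half 0<n 2n²≤7m 2S≤n³
      (sorted-target adm₁) (sorted-target adm₂) (sorted-target adm₃)))))))

-- Either `S` or the number `n³ - S` of edges of the complement is at most half of `n³`.
realize : ∀ {n m S} → 0 < n → 2 * (n * n) ℕ.≤ 7 * m → {D₁ D₂ D₃ : Fin n → ℕ} →
          Admissible m S D₁ → Admissible m S D₂ → Admissible m S D₃ → Realization D₁ D₂ D₃
realize {n} {m} {S} 0<n 2n²≤7m adm₁ adm₂ adm₃ with ℕₚ.≤-total (S + S) (n * (n * n))
... | inj₁ 2S≤n³ = realize-half 0<n 2n²≤7m 2S≤n³ adm₁ adm₂ adm₃
... | inj₂ n³≤2S = complement (admissible-≤ adm₁) (admissible-≤ adm₂) (admissible-≤ adm₃)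
    (realize-half 0<n 2n²≤7m 2S′≤n³
      (complement-admissible adm₁) (complement-admissible adm₂) (complement-admissible adm₃))
  where
  S′ = n * (n * n) ∸ S
  2S′≤n³ : S′ + S′ ℕ.≤ n * (n * n)
  2S′≤n³ = begin
    S′ + S′              ≤⟨ ℕₚ.+-monoʳ-≤ S′ (ℕₚ.m≤n+o⇒m∸n≤o (n * (n * n)) S n³≤2S) ⟩
    S′ + S               ≡⟨ ℕₚ.m∸n+n≡m (subst (S ℕ.≤_) (sum-complement adm₁) (ℕₚ.m≤n+m S _)) ⟩
    n * (n * n)          ∎
    where open ≤-Reasoning

-- From indicator functions to lists of hyperedges

sumᴸ-++ : {A : Set} (h : A → ℕ) (xs ys : List A) →
          sumᴸ (map h (xs ++ ys)) ≡ sumᴸ (map h xs) + sumᴸ (map h ys)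
sumᴸ-++ h xs ys = trans (cong sumᴸ (map-++ h xs ys)) (sum-++ (map h xs) (map h ys))

sumᴸ-cartesianProduct : {A B : Set} (h : A × B → ℕ) (xs : List A) (ys : List B) →
  sumᴸ (map h (cartesianProduct xs ys)) ≡ sumᴸ (map (λ x → sumᴸ (map (λ y → h (x , y)) ys)) xs)
sumᴸ-cartesianProduct h []       ys = refl
sumᴸ-cartesianProduct h (x ∷ xs) ys = trans
  (sumᴸ-++ h (map (x ,_) ys) (cartesianProduct xs ys))
  (cong₂ _+_ (cong sumᴸ (sym (map-∘ ys))) (sumᴸ-cartesianProduct h xs ys))

sumᴸ-tabulate : (h : Fin n → ℕ) → sumᴸ (tabulate h) ≡ sum h
sumᴸ-tabulate {zero}  h = refl
sumᴸ-tabulate {suc n} h = cong (h zero +_) (sumᴸ-tabulate (h ∘ suc))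

sumᴸ-allFin : (h : Fin n → ℕ) → sumᴸ (map h (allFin n)) ≡ sum h
sumᴸ-allFin h = trans (cong sumᴸ (map-tabulate id h)) (sumᴸ-tabulate h)

-- Turns the degree of a vertex in a filtered list of edges into a sum of products of indicators,
-- which can then be compared with `Σ₃`.
length-filter-map-filter : {A B : Set} {P : A → Set} {Q : B → Set}
  (P? : ∀ a → Dec (P a)) (Q? : ∀ b → Dec (Q b)) (f : A → B) (xs : List A) →
  length (filter Q? (map f (filter P? xs))) ≡
    sumᴸ (map (λ a → ⟦ does (Q? (f a)) ⟧ * ⟦ does (P? a) ⟧) xs)
length-filter-map-filter P? Q? f [] = refl
length-filter-map-filter P? Q? f (x ∷ xs) with does (P? x)
... | false rewrite ℕₚ.*-zeroʳ ⟦ does (Q? (f x)) ⟧ = length-filter-map-filter P? Q? f xs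
... | true with does (Q? (f x))
...   | false = length-filter-map-filter P? Q? f xs
...   | true  = cong suc (length-filter-map-filter P? Q? f xs)

Σ₃-δ : (v : Fin n) (f : Fin n → Fin n → Fin n → ℕ) → Σ₃ (λ x y z → δ v x * f x y z) ≡ Σ₂ (f v)
Σ₃-δ v f = trans
  (sum-cong-≗ λ x → sym (trans (*-distribˡ-sum (δ v x) (λ y → sum (f x y)))
                               (sum-cong-≗ λ y → *-distribˡ-sum (δ v x) (f x y))))
  (sum-δ v (λ x → Σ₂ (f x)))

module _ {D : DegreeSequence (λ _ → n)} (R : Realization (D 0F) (D 1F) (D 2F)) where

  private
    Triple : Set
    Triple = Fin n × Fin n × Fin n

    present? : (t : Triple) → Dec (edge R (proj₁ t) (proj₁ (proj₂ t)) (proj₂ (proj₂ t)) ≡ 1)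
    present? (x , y , z) = edge R x y z ℕₚ.≟ 1

    vertices : Triple → VertexSet (λ _ → n)
    vertices (x , y , z) = ⟨ ⁅ x ⁆ , ⁅ y ⁆ , ⁅ z ⁆ ⟩

    triples : List Triple
    triples = cartesianProduct (allFin n) (cartesianProduct (allFin n) (allFin n))

    ⁅⁆-injective : {x y : Fin n} → ⁅ x ⁆ ≡ ⁅ y ⁆ → x ≡ y
    ⁅⁆-injective {x} {y} eq = x∈⁅y⁆⇒x≡y y (subst (x ∈_) eq (x∈⁅x⁆ x))

    vertices-injective : {s t : Triple} → vertices s ≡ vertices t → s ≡ t
    vertices-injective eq = cong₂ _,_ (⁅⁆-injective (cong VertexSet.part₁ eq))
      (cong₂ _,_ (⁅⁆-injective (cong VertexSet.part₂ eq)) (⁅⁆-injective (cong VertexSet.part₃ eq)))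

    H : TripartiteHypergraph (λ _ → n)
    H = record
      { E          = map vertices (filter present? triples)
      ; hyperedges = All.map⁺ (universal (λ { (x , y , z) →
          λ { 0F → ∣⁅x⁆∣≡1 x ; 1F → ∣⁅x⁆∣≡1 y ; 2F → ∣⁅x⁆∣≡1 z } }) _)
      ; distinct   = Unique.map⁺ vertices-injective (Unique.filter⁺ present?
          (Unique.cartesianProduct⁺ (Unique.allFin⁺ n)
            (Unique.cartesianProduct⁺ (Unique.allFin⁺ n) (Unique.allFin⁺ n))))
      }

    ⟦present?⟧ : ∀ x y z → ⟦ does (edge R x y z ℕₚ.≟ 1) ⟧ ≡ edge R x y z
    ⟦present?⟧ x y z with edge R x y z | edge≤1 R x y z
    ... | 0 | _ = refl
    ... | 1 | _ = refl
    ... | suc (suc _) | s≤s ()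

    coordinate : (k : Fin 3) → Fin n → Fin n → Fin n → Fin n
    coordinate 0F x y z = x
    coordinate 1F x y z = y
    coordinate 2F x y z = z

    ⟦∈?⟧ : ∀ k v x y z → ⟦ does (v ∈? (vertices (x , y , z) ∩class k)) ⟧ ≡ δ v (coordinate k x y z)
    ⟦∈?⟧ 0F v x y z = cong ⟦_⟧ (does-⇔ x∈⁅y⁆⇔x≡y (v ∈? ⁅ x ⁆) (v ≟ x))
    ⟦∈?⟧ 1F v x y z = cong ⟦_⟧ (does-⇔ x∈⁅y⁆⇔x≡y (v ∈? ⁅ y ⁆) (v ≟ y))
    ⟦∈?⟧ 2F v x y z = cong ⟦_⟧ (does-⇔ x∈⁅y⁆⇔x≡y (v ∈? ⁅ z ⁆) (v ≟ z))

    degree-H : ∀ k v → degree H k v ≡ Σ₃ (λ x y z → δ v (coordinate k x y z) * edge R x y z)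
    degree-H k v = begin
      degree H k v
        ≡⟨ length-filter-map-filter present? (λ e → v ∈? (e ∩class k)) vertices triples ⟩
      sumᴸ (map h triples)
        ≡⟨ sumᴸ-cartesianProduct h (allFin n) (cartesianProduct (allFin n) (allFin n)) ⟩
      sumᴸ (map (λ x → sumᴸ (map (λ t → h (x , t)) (cartesianProduct (allFin n) (allFin n)))) (allFin n))
        ≡⟨ sumᴸ-allFin (λ x → sumᴸ (map (λ t → h (x , t)) (cartesianProduct (allFin n) (allFin n)))) ⟩
      sum (λ x → sumᴸ (map (λ t → h (x , t)) (cartesianProduct (allFin n) (allFin n))))
        ≡⟨ sum-cong-≗ (λ x → trans (sumᴸ-cartesianProduct (λ t → h (x , t)) (allFin n) (allFin n))
             (trans (sumᴸ-allFin (λ y → sumᴸ (map (λ z → h (x , y , z)) (allFin n))))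
               (sum-cong-≗ λ y → sumᴸ-allFin (λ z → h (x , y , z))))) ⟩
      Σ₃ (λ x y z → h (x , y , z))
        ≡⟨ sum-cong-≗ (λ x → Σ₂-cong λ y z → cong₂ _*_ (⟦∈?⟧ k v x y z) (⟦present?⟧ x y z)) ⟩
      Σ₃ (λ x y z → δ v (coordinate k x y z) * edge R x y z) ∎
      where
      open ≡-Reasoning
      h : Triple → ℕ
      h t = ⟦ does (v ∈? (vertices t ∩class k)) ⟧ * ⟦ does (present? t) ⟧

    degree≡D : ∀ k v → degree H k v ≡ D k v
    degree≡D 0F v = trans (degree-H 0F v) (trans (Σ₃-δ v (edge R)) (deg₁ R v))
    -- Rotating the order of summation puts the class of `v` first, where `Σ₃-δ` applies.
    degree≡D 1F v = trans (degree-H 1F v) (trans (sym (Σ₃-rotate (λ x y z → δ v y * edge R x y z)))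
      (trans (Σ₃-δ v (λ y z x → edge R x y z)) (deg₂ R v)))
    degree≡D 2F v = trans (degree-H 2F v) (trans (Σ₃-rotate (λ z x y → δ v z * edge R x y z))
      (trans (Σ₃-δ v (λ z x y → edge R x y z)) (deg₃ R v)))

  graphic : Graphic (λ _ → n) D
  graphic = H , degree≡D

-- Opened only here, since +_ clashes with operator sections.
open import Data.Integer.Base using (+_)
open import Data.Rational.Unnormalised.Base using (_/_; _≤_)

-- From the rational bounds to an integer bound

fraction-≤-integer : ∀ a d → + a / 7 ≤ + d / 1 → a ℕ.≤ d * 7
fraction-≤-integer a d p = subst (ℕ._≤ d * 7) (ℕₚ.*-identityʳ a)
  (ℤ.drop‿+≤+ (subst₂ ℤ._≤_ (sym (ℤ.pos-* a 1)) (sym (ℤ.pos-* d 7)) (ℚᵘ.drop-*≤* p)))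

integer-≤-fraction : ∀ a d → + d / 1 ≤ + a / 7 → d * 7 ℕ.≤ a
integer-≤-fraction a d p = subst (d * 7 ℕ.≤_) (ℕₚ.*-identityʳ a)
  (ℤ.drop‿+≤+ (subst₂ ℤ._≤_ (sym (ℤ.pos-* d 7)) (sym (ℤ.pos-* a 1)) (ℚᵘ.drop-*≤* p)))

⌈_/7⌉ : ℕ → ℕ
⌈ a /7⌉ = (a + 6) DivMod./ 7

⌈/7⌉-upper : ∀ a → a ℕ.≤ 7 * ⌈ a /7⌉
⌈/7⌉-upper a = ℕₚ.+-cancelʳ-≤ 6 _ _ (begin
  a + 6                          ≡⟨ m≡m%n+[m/n]*n (a + 6) 7 ⟩
  (a + 6) % 7 + ⌈ a /7⌉ * 7      ≤⟨ ℕₚ.+-monoˡ-≤ (⌈ a /7⌉ * 7) (ℕₚ.≤-pred (m%n<n (a + 6) 7)) ⟩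
  6 + ⌈ a /7⌉ * 7                ≡⟨ ℕₚ.+-comm 6 _ ⟩
  ⌈ a /7⌉ * 7 + 6                ≡⟨ cong (_+ 6) (ℕₚ.*-comm ⌈ a /7⌉ 7) ⟩
  7 * ⌈ a /7⌉ + 6                ∎)
  where open ≤-Reasoning

⌈/7⌉-least : ∀ a d → a ℕ.≤ d * 7 → ⌈ a /7⌉ ℕ.≤ d
⌈/7⌉-least a d a≤7d = ℕₚ.≤-pred (m<n*o⇒m/o<n (begin-strict
  a + 6        <⟨ ℕₚ.+-mono-≤-< a≤7d ℕₚ.≤-refl ⟩
  d * 7 + 7    ≡⟨ ℕₚ.+-comm (d * 7) 7 ⟩
  suc d * 7    ∎))
  where open ≤-Reasoning

theorem3p1 : (n : ℕ) → .{{_ : NonZero n}} → (D : DegreeSequence (λ _ → n)) →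
    sum (D 0F) ≡ sum (D 1F) → sum (D 1F) ≡ sum (D 2F) →
    (∀ k i → + (2 * n ^ 2) / 7 ≤ + (D k i) / 1) →
    (∀ k i → + (D k i) / 1 ≤ + (5 * n ^ 2) / 7) →
    Graphic (λ _ → n) D
theorem3p1 n D ∑₀≡∑₁ ∑₁≡∑₂ lower upper = graphic (realize (ℕ.>-nonZero⁻¹ n) (⌈/7⌉-upper (2 * (n * n)))
    (admissible 0F refl) (admissible 1F (sym ∑₀≡∑₁)) (admissible 2F (sym (trans ∑₀≡∑₁ ∑₁≡∑₂))))
  where
  n² = n * n
  m = ⌈ 2 * n² /7⌉
  n^2≡n² : n ^ 2 ≡ n²
  -- `n ^ 2` unfolds to `n * (n * 1)`.
  n^2≡n² = cong (n *_) (ℕₚ.*-identityʳ n)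
  2n²≤7D : ∀ k i → 2 * n² ℕ.≤ D k i * 7
  2n²≤7D k i = fraction-≤-integer (2 * n²) (D k i)
    (subst (λ q → + (2 * q) / 7 ≤ + (D k i) / 1) n^2≡n² (lower k i))
  7D≤5n² : ∀ k i → D k i * 7 ℕ.≤ 5 * n²
  7D≤5n² k i = integer-≤-fraction (5 * n²) (D k i)
    (subst (λ q → + (D k i) / 1 ≤ + (5 * q) / 7) n^2≡n² (upper k i))
  7D+2n²≤7n² : ∀ k i → 2 * n² + D k i * 7 ℕ.≤ n² * 7
  7D+2n²≤7n² k i = ℕₚ.≤-trans (ℕₚ.+-monoʳ-≤ (2 * n²) (7D≤5n² k i)) (ℕₚ.≤-reflexive (seven n²))
    where
    seven : ∀ q → 2 * q + 5 * q ≡ q * 7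
    seven = solve-∀
  D≤n² : ∀ k i → D k i ℕ.≤ n²
  D≤n² k i = ℕₚ.*-cancelʳ-≤ (D k i) n² 7 (ℕₚ.m+n≤o⇒n≤o (2 * n²) (7D+2n²≤7n² k i))
  -- The upper bound `5n²/7` says that the complementary degree is at least `2n²/7`, so rounding up
  -- to `m` is valid for it as well.
  m≤n²∸D : ∀ k i → m ℕ.≤ n² ∸ D k i
  m≤n²∸D k i = ⌈/7⌉-least (2 * n²) (n² ∸ D k i)
    (subst (2 * n² ℕ.≤_) (sym (ℕₚ.*-distribʳ-∸ 7 n² (D k i)))
      (ℕₚ.m+n≤o⇒m≤o∸n (2 * n²) (7D+2n²≤7n² k i)))
  admissible : ∀ k → sum (D k) ≡ sum (D 0F) → Admissible m (sum (D 0F)) (D k)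
  admissible k ∑≡ = record
    { lower = λ i → ⌈/7⌉-least (2 * n²) (D k i) (2n²≤7D k i)
    ; upper = λ i → subst (D k i + m ℕ.≤_) (ℕₚ.m+[n∸m]≡n (D≤n² k i)) (ℕₚ.+-monoʳ-≤ (D k i) (m≤n²∸D k i))
    ; total = ∑≡
    }
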